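{- Let $\mathsf{Ctx}$ be the category of contexts for a functional language $\mathbb{F}$, and let $(\mathbf{P}_n\colon\mathsf{Ctx}^{\mathrm{op}}\to\mathsf{BA})_{n\in\mathbb{N}}$ be a QA-stratified Boolean doctrine over $\mathsf{Ctx}$. Then there are a relational language $\mathbb{P}$ (a set of predicate symbols with arities), a theory $\mathcal{T}$ in the first-order language $(\mathbb{F},\mathbb{P})$, and an isomorphism of QA-stratified Boolean doctrines between $(\mathbf{P}_n)_{n\in\mathbb{N}}$ and $(\mathsf{LT}^{\mathcal{T}}_n)_{n\in\mathbb{N}}$.
   Context: $\mathbb{N}$ contains $0$. $\mathsf{BA}$ is the category of Boolean algebras and Boolean homomorphisms. QA-one-step Boolean doctrine over a category $\mathsf{C}$ with finite products: a componentwise injective natural transformation $i\colon\mathbf{P}_0\hookrightarrow\mathbf{P}_1$ between functors $\mathbf{P}_0,\mathbf{P}_1\colon\mathsf{C}^{\mathrm{op}}\to\mathsf{BA}$ such that: (1) for all $X,Y\in\mathsf{C}$ and $\beta\in\mathbf{P}_0(X\times Y)$ there is a (necessarily unique) element $(\forall Y)_X\beta\in\mathbf{P}_1(X)$ such that for all $\alpha\in\mathbf{P}_1(X)$: $\alpha\le(\forall Y)_X\beta$ iff $\mathbf{P}_1(\mathrm{pr}_1)(\alpha)\le i_{X\times Y}(\beta)$, where $\mathrm{pr}_1\colon X\times Y\to X$; (2) for every $f\colon X'\to X$ and every $Y$, $\mathbf{P}_1(f)\circ(\forall Y)_X=(\forall Y)_{X'}\circ\mathbf{P}_0(f\times\mathrm{id}_Y)$;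 (3) for all $X$, the Boolean algebra $\mathbf{P}_1(X)$ is generated by the union over $Y\in\mathsf{C}$ of the images of $(\forall Y)_X\colon\mathbf{P}_0(X\times Y)\to\mathbf{P}_1(X)$. QA-stratified Boolean doctrine over $\mathsf{C}$: a sequence of functors $(\mathbf{P}_n\colon\mathsf{C}^{\mathrm{op}}\to\mathsf{BA})_{n\in\mathbb{N}}$ and QA-one-step Boolean doctrines $(i_n\colon\mathbf{P}_n\hookrightarrow\mathbf{P}_{n+1})_{n\in\mathbb{N}}$, with one-step quantifiers $(\forall Y)_{X,n}\colon\mathbf{P}_n(X\times Y)\to\mathbf{P}_{n+1}(X)$, such that $(i_{n+1})_X\circ(\forall Y)_{X,n}=(\forall Y)_{X,n+1}\circ(i_n)_{X\times Y}$ for all $X,Y,n$. Morphism of QA-stratified Boolean doctrines from $(\mathbf{P}_n)_n$ over $\mathsf{C}$ to $(\mathbf{R}_n)_n$ over $\mathsf{D}$: a finite-product-preserving functor $M\colon\mathsf{C}\to\mathsf{D}$ and natural transformations $\mathfrak{m}_n\colon\mathbf{P}_n\to\mathbf{R}_n\circ M^{\mathrm{op}}$ ($n\in\mathbb{N}$) that commute with the injections $i_n$ and satisfy $(\mathfrak{m}_{n+1})_X\circ(\forall Y)_{X,n}=(\forall M(Y))_{M(X),n}\circ(\mathfrak{m}_n)_{X\times Y}$ for all $X,Y,n$. Syntax. A first-order language $(\mathbb{F},\mathbb{P})$ (without equality) has function symbols $\mathbb{F}$ and predicate symbols $\mathbb{P}$. Formulas are considered up to renaming of bound variables. A context is a finite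 list of distinct variables; $\alpha:\vec x$ means that the free variables of $\alpha$ are among $\vec x$. A theory is a set of closed formulas. $\mathsf{Ctx}$, the category of contexts for $\mathbb{F}$, has contexts as objects; a morphism $(x_1,\dots,x_n)\to(y_1,\dots,y_m)$ is an $m$-tuple of $\mathbb{F}$-terms with variables among $\vec x$; composition is simultaneous substitution. It has finite products (concatenation of contexts after renaming; the terminal object is the empty list $()$). Provability: sequents $\Gamma\Rightarrow_{\vec y}\Delta$ carry a context $\vec y$, with $\Gamma,\Delta$ finite lists of formulas in context $\vec y$. The rules are those of the classical sequent calculus (identity, weakening, contraction, exchange, cut, left/right rules for $\top,\bot,\land,\lor,\lnot,\to$), all within one fixed context, together with: context enlargement (from $\Gamma\Rightarrow_{\vec y}\Delta$ infer $\Gamma\Rightarrow_{(\vec y,x)}\Delta$, $x\notin\vec y$); (L$\forall$) from $\zeta[t/x],\Gamma\Rightarrow_{\vec y}\Delta$ infer $\forall x\,\zeta,\Gamma\Rightarrow_{\vec y}\Delta$, where $t$ is a term with variables in $\vec y$; (R$\forall$) from $\Gamma\Rightarrow_{(\vec y,x)}\Delta,\zeta$ infer $\Gamma\Rightarrow_{\vec y}\Delta,\forall x\,\zeta$, where $\Gamma,\Delta$ are in context $\vec y$ and $x\notin\vec y$; and the dual rules (L$\exists$), (R$\exists$). (So the empty structure is admitted as a model.) A sequent is provable from $\mathcal{T}$ if it is derivable with additional axioms $\Rightarrow_{()}\varphi$ for $\varphi\in\mathcal{T}$. The syntactic doctrine $\mathsf{LT}^{\mathcal{T}}\colon\mathsf{Ctx}^{\mathrm{op}}\to\mathsf{BA}$: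 $\mathsf{LT}^{\mathcal{T}}(\vec x)$ is the poset reflection of the set of formulas in context $\vec x$ preordered by: $\alpha$ below $\beta$ iff $\alpha\Rightarrow_{\vec x}\beta$ is provable from $\mathcal{T}$; reindexing is substitution. $\mathsf{LT}^{\mathcal{T}}_0(\vec x)\subseteq\mathsf{LT}^{\mathcal{T}}(\vec x)$ is the set of equivalence classes of quantifier-free formulas in context $\vec x$; $\mathsf{LT}^{\mathcal{T}}_{n+1}(\vec x)$ is the Boolean subalgebra of $\mathsf{LT}^{\mathcal{T}}(\vec x)$ generated by the elements $\forall\vec y\,\alpha(\vec x,\vec y)$ with $\vec y$ ranging over contexts (disjoint from $\vec x$) and $\alpha\in\mathsf{LT}^{\mathcal{T}}_n(\vec x,\vec y)$. Each $\mathsf{LT}^{\mathcal{T}}_n$ is a subfunctor of $\mathsf{LT}^{\mathcal{T}}$, and $(\mathsf{LT}^{\mathcal{T}}_n)_n$ with the inclusions and the restrictions of $\forall\vec y$ is a QA-stratified Boolean doctrine. -}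

module Defs where

open import Level using (Level; _⊔_; 0ℓ) renaming (suc to lsuc)
open import Data.Fin.Base using (Fin; zero; suc; _↑ˡ_; _↑ʳ_)
open import Data.List.Base as List using (List; []; _∷_)
import Data.List.Properties as List
open import Data.List.Relation.Binary.Permutation.Propositional using (_↭_; ↭-refl; swap)
open import Data.List.Relation.Binary.Permutation.Propositional.Properties using (map⁺)
open import Data.Nat.Base using (ℕ; zero; suc; _+_)
open import Data.Product.Base using (Σ; ∃; ∃-syntax; Σ-syntax; _×_; _,_; proj₁; proj₂)
open import Data.Vec.Base as Vec using (Vec; []; _∷_; lookup; tabulate; _++_)
import Data.Vec.Properties as Vec
open import Function.Base using (_∘_)
open import Function.Bundles using (_⇔_; mk⇔; Equivalence)
open import Function.Definitions using (Injective)
open import Relation.Binary.Core using (Rel)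
open import Relation.Binary.Lattice.Bundles using (BooleanAlgebra)
open import Relation.Binary.PropositionalEquality.Core
  using (_≡_; refl; sym; trans; cong; cong₂; subst; subst₂)
open import Relation.Binary.PropositionalEquality.Properties using (isEquivalence)
open import Relation.Binary.Structures using (IsEquivalence)
open import Relation.Unary using (Pred)

private
  variable
    o h e o′ h′ e′ ℓ ℓ′ : Level

record Category (o h e : Level) : Set (lsuc (o ⊔ h ⊔ e)) where
  infix  4 _≈_ _⟶_
  infixr 9 _∘ᶜ_
  field
    Obj       : Set o
    _⟶_       : Obj → Obj → Set h
    _≈_       : ∀ {X Y} → Rel (X ⟶ Y) e
    id        : ∀ {X} → X ⟶ X
    _∘ᶜ_      : ∀ {X Y Z} → Y ⟶ Z → X ⟶ Y → X ⟶ Z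
    ≈-equiv   : ∀ {X Y} → IsEquivalence (_≈_ {X} {Y})
    ∘-resp-≈  : ∀ {X Y Z} {g g′ : Y ⟶ Z} {f f′ : X ⟶ Y} →
                g ≈ g′ → f ≈ f′ → g ∘ᶜ f ≈ g′ ∘ᶜ f′
    assoc     : ∀ {W X Y Z} (k : Y ⟶ Z) (g : X ⟶ Y) (f : W ⟶ X) →
                (k ∘ᶜ g) ∘ᶜ f ≈ k ∘ᶜ (g ∘ᶜ f)
    identityˡ : ∀ {X Y} (f : X ⟶ Y) → id ∘ᶜ f ≈ f
    identityʳ : ∀ {X Y} (f : X ⟶ Y) → f ∘ᶜ id ≈ f

op : Category o h e → Category o h e
op C = record
  { Obj       = Obj
  ; _⟶_       = λ X Y → Y ⟶ X
  ; _≈_       = _≈_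
  ; id        = id
  ; _∘ᶜ_      = λ g f → f ∘ᶜ g
  ; ≈-equiv   = ≈-equiv
  ; ∘-resp-≈  = λ p q → ∘-resp-≈ q p
  ; assoc     = λ k g f → IsEquivalence.sym ≈-equiv (assoc f g k)
  ; identityˡ = identityʳ
  ; identityʳ = identityˡ
  }
  where open Category C

record Functor (C : Category o h e) (D : Category o′ h′ e′) :
               Set (o ⊔ h ⊔ e ⊔ o′ ⊔ h′ ⊔ e′) where
  private
    module C = Category C
    module D = Category D
  field
    F₀           : C.Obj → D.Obj
    F₁           : ∀ {X Y} → X C.⟶ Y → F₀ X D.⟶ F₀ Y
    F-resp-≈     : ∀ {X Y} {f g : X C.⟶ Y} → f C.≈ g → F₁ f D.≈ F₁ g
    identity     : ∀ {X} → F₁ (C.id {X}) D.≈ D.id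
    homomorphism : ∀ {X Y Z} (g : Y C.⟶ Z) (f : X C.⟶ Y) →
                   F₁ (g C.∘ᶜ f) D.≈ F₁ g D.∘ᶜ F₁ f

opF : {C : Category o h e} {D : Category o′ h′ e′} → Functor C D → Functor (op C) (op D)
opF F = record
  { F₀           = F₀
  ; F₁           = F₁
  ; F-resp-≈     = F-resp-≈
  ; identity     = identity
  ; homomorphism = λ g f → homomorphism f g
  }
  where open Functor F

infixr 9 _∘F_

_∘F_ : ∀ {o″ h″ e″} {C : Category o h e} {D : Category o′ h′ e′} {E : Category o″ h″ e″} →
       Functor D E → Functor C D → Functor C E
_∘F_ {E = E} G F = record
  { F₀           = G.F₀ ∘ F.F₀
  ; F₁           = G.F₁ ∘ F.F₁
  ; F-resp-≈     = G.F-resp-≈ ∘ F.F-resp-≈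
  ; identity     = E.trans (G.F-resp-≈ F.identity) G.identity
  ; homomorphism = λ g f → E.trans (G.F-resp-≈ (F.homomorphism g f))
                                   (G.homomorphism (F.F₁ g) (F.F₁ f))
  }
  where
  module F = Functor F
  module G = Functor G
  module E {X Y} = IsEquivalence (Category.≈-equiv E {X} {Y})

record NaturalTransformation {C : Category o h e} {D : Category o′ h′ e′}
                             (F G : Functor C D) : Set (o ⊔ h ⊔ h′ ⊔ e′) where
  private
    module C = Category C
    module D = Category D
    module F = Functor F
    module G = Functor G
  field
    η       : ∀ X → F.F₀ X D.⟶ G.F₀ X
    commute : ∀ {X Y} (f : X C.⟶ Y) → η Y D.∘ᶜ F.F₁ f D.≈ G.F₁ f D.∘ᶜ η X

module _ (C : Category o h e) where
  open Category C

  record IsTerminal (Z : Obj) : Set (o ⊔ h ⊔ e) where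
    field
      !        : ∀ {X} → X ⟶ Z
      !-unique : ∀ {X} (f : X ⟶ Z) → ! ≈ f

  record IsProduct {X Y P : Obj} (p : P ⟶ X) (q : P ⟶ Y) : Set (o ⊔ h ⊔ e) where
    field
      ⟨_,_⟩    : ∀ {Z} → Z ⟶ X → Z ⟶ Y → Z ⟶ P
      project₁ : ∀ {Z} (f : Z ⟶ X) (g : Z ⟶ Y) → p ∘ᶜ ⟨ f , g ⟩ ≈ f
      project₂ : ∀ {Z} (f : Z ⟶ X) (g : Z ⟶ Y) → q ∘ᶜ ⟨ f , g ⟩ ≈ g
      unique   : ∀ {Z} {f : Z ⟶ X} {g : Z ⟶ Y} (k : Z ⟶ P) →
                 p ∘ᶜ k ≈ f → q ∘ᶜ k ≈ g → ⟨ f , g ⟩ ≈ k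

  record FiniteProducts : Set (o ⊔ h ⊔ e) where
    infixr 7 _⊗_
    field
      𝟙          : Obj
      isTerminal : IsTerminal 𝟙
      _⊗_        : Obj → Obj → Obj
      π₁         : ∀ {X Y} → X ⊗ Y ⟶ X
      π₂         : ∀ {X Y} → X ⊗ Y ⟶ Y
      isProduct  : ∀ {X Y} → IsProduct (π₁ {X} {Y}) π₂

    open module IsProductOf {X Y} = IsProduct (isProduct {X} {Y}) public

    _⊗id : ∀ {X X′ Y} → X′ ⟶ X → X′ ⊗ Y ⟶ X ⊗ Y
    f ⊗id = ⟨ f ∘ᶜ π₁ , π₂ ⟩

record PreservesFiniteProducts {C : Category o h e} {D : Category o′ h′ e′}
                               (𝒞 : FiniteProducts C) (𝒟 : FiniteProducts D)
                               (M : Functor C D) : Set (o ⊔ h ⊔ e ⊔ o′ ⊔ h′ ⊔ e′) where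
  private
    module C = FiniteProducts 𝒞
    module D = FiniteProducts 𝒟
  open Category D using (_⟶_)
  open Functor M
  field
    preserves-𝟙 : IsTerminal D (F₀ C.𝟙)
    preserves-⊗ : ∀ X Y → IsProduct D (F₁ (C.π₁ {X} {Y})) (F₁ C.π₂)

  -- The canonical isomorphism along which M(X × Y) is identified with M X × M Y.
  comparison : ∀ X Y → F₀ X D.⊗ F₀ Y ⟶ F₀ (X C.⊗ Y)
  comparison X Y = IsProduct.⟨_,_⟩ (preserves-⊗ X Y) D.π₁ D.π₂

∣_∣ : BooleanAlgebra ℓ ℓ ℓ → Set ℓ
∣ B ∣ = BooleanAlgebra.Carrier B

record BooleanHomomorphism (A B : BooleanAlgebra ℓ ℓ ℓ) : Set ℓ where
  private
    module A = BooleanAlgebra A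
    module B = BooleanAlgebra B
  field
    ⟦_⟧     : ∣ A ∣ → ∣ B ∣
    ⟦⟧-cong : ∀ {x y} → x A.≈ y → ⟦ x ⟧ B.≈ ⟦ y ⟧
    ∧-homo  : ∀ x y → ⟦ x A.∧ y ⟧ B.≈ ⟦ x ⟧ B.∧ ⟦ y ⟧
    ∨-homo  : ∀ x y → ⟦ x A.∨ y ⟧ B.≈ ⟦ x ⟧ B.∨ ⟦ y ⟧
    ¬-homo  : ∀ x → ⟦ A.¬ x ⟧ B.≈ B.¬ ⟦ x ⟧
    ⊤-homo  : ⟦ A.⊤ ⟧ B.≈ B.⊤
    ⊥-homo  : ⟦ A.⊥ ⟧ B.≈ B.⊥

open BooleanHomomorphism using (⟦_⟧)

module BALaws (B : BooleanAlgebra ℓ ℓ ℓ) where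
  open BooleanAlgebra B renaming (trans to ≤-trans; refl to ≤-refl)

  ∧-mono : ∀ {x x′ y y′} → x ≤ x′ → y ≤ y′ → x ∧ y ≤ x′ ∧ y′
  ∧-mono {x} {x′} {y} {y′} p q = proj₂ (proj₂ (infimum x′ y′)) (x ∧ y)
    (≤-trans (proj₁ (infimum x y)) p) (≤-trans (proj₁ (proj₂ (infimum x y))) q)

  ∨-mono : ∀ {x x′ y y′} → x ≤ x′ → y ≤ y′ → x ∨ y ≤ x′ ∨ y′
  ∨-mono {x} {x′} {y} {y′} p q = proj₂ (proj₂ (supremum x y)) (x′ ∨ y′)
    (≤-trans p (proj₁ (supremum x′ y′))) (≤-trans q (proj₁ (proj₂ (supremum x′ y′))))

  ∧-cong : ∀ {x x′ y y′} → x ≈ x′ → y ≈ y′ → x ∧ y ≈ x′ ∧ y′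
  ∧-cong p q = antisym (∧-mono (reflexive p) (reflexive q))
                       (∧-mono (reflexive (Eq.sym p)) (reflexive (Eq.sym q)))

  ∨-cong : ∀ {x x′ y y′} → x ≈ x′ → y ≈ y′ → x ∨ y ≈ x′ ∨ y′
  ∨-cong p q = antisym (∨-mono (reflexive p) (reflexive q))
                       (∨-mono (reflexive (Eq.sym p)) (reflexive (Eq.sym q)))

  ¬-anti : ∀ {x y} → x ≤ y → ¬ y ≤ ¬ x
  ¬-anti {x} {y} p = ≤-trans (transpose-⇨ {¬ y} {x} {⊥} ¬y∧x≤⊥)
    (proj₂ (proj₂ (supremum (¬ x) ⊥)) (¬ x) ≤-refl (minimum (¬ x)))
    where
    ¬y∧x≤⊥ : ¬ y ∧ x ≤ ⊥
    ¬y∧x≤⊥ = ≤-trans (∧-mono ≤-refl p)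
      (transpose-∧ {¬ y} {y} {⊥} (proj₁ (supremum (¬ y) ⊥)))

  ¬-cong : ∀ {x y} → x ≈ y → ¬ x ≈ ¬ y
  ¬-cong p = antisym (¬-anti (reflexive (Eq.sym p))) (¬-anti (reflexive p))

BA : (ℓ : Level) → Category (lsuc ℓ) ℓ ℓ
BA ℓ = record
  { Obj       = BooleanAlgebra ℓ ℓ ℓ
  ; _⟶_       = BooleanHomomorphism
  ; _≈_       = λ {A} {B} f g → ∀ x → BooleanAlgebra._≈_ B (⟦ f ⟧ x) (⟦ g ⟧ x)
  ; id        = λ {A} → let open BooleanAlgebra.Eq A renaming (refl to ≈-refl) in record
    { ⟦_⟧     = λ x → x
    ; ⟦⟧-cong = λ p → p
    ; ∧-homo  = λ _ _ → ≈-refl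
    ; ∨-homo  = λ _ _ → ≈-refl
    ; ¬-homo  = λ _ → ≈-refl
    ; ⊤-homo  = ≈-refl
    ; ⊥-homo  = ≈-refl
    }
  ; _∘ᶜ_      = _∘ᴮ_
  ; ≈-equiv   = λ {A} {B} → let module B = BooleanAlgebra.Eq B in record
    { refl  = λ _ → B.refl
    ; sym   = λ p x → B.sym (p x)
    ; trans = λ p q x → B.trans (p x) (q x)
    }
  ; ∘-resp-≈  = λ {_} {_} {C} {_} {g′} {f} p q x →
                BooleanAlgebra.Eq.trans C (p (⟦ f ⟧ x)) (BooleanHomomorphism.⟦⟧-cong g′ (q x))
  ; assoc     = λ {_} {_} {_} {D} _ _ _ _ → BooleanAlgebra.Eq.refl D
  ; identityˡ = λ {_} {B} _ _ → BooleanAlgebra.Eq.refl B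
  ; identityʳ = λ {_} {B} _ _ → BooleanAlgebra.Eq.refl B
  }
  where
  _∘ᴮ_ : {A B C : BooleanAlgebra ℓ ℓ ℓ} →
         BooleanHomomorphism B C → BooleanHomomorphism A B → BooleanHomomorphism A C
  _∘ᴮ_ {C = C} g f = record
    { ⟦_⟧     = λ x → ⟦ g ⟧ (⟦ f ⟧ x)
    ; ⟦⟧-cong = g.⟦⟧-cong ∘ f.⟦⟧-cong
    ; ∧-homo  = λ x y → C.trans (g.⟦⟧-cong (f.∧-homo x y)) (g.∧-homo _ _)
    ; ∨-homo  = λ x y → C.trans (g.⟦⟧-cong (f.∨-homo x y)) (g.∨-homo _ _)
    ; ¬-homo  = λ x → C.trans (g.⟦⟧-cong (f.¬-homo x)) (g.¬-homo _)
    ; ⊤-homo  = C.trans (g.⟦⟧-cong f.⊤-homo) g.⊤-homo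
    ; ⊥-homo  = C.trans (g.⟦⟧-cong f.⊥-homo) g.⊥-homo
    }
    where
    module f = BooleanHomomorphism f
    module g = BooleanHomomorphism g
    module C = BooleanAlgebra.Eq C

data Generated (B : BooleanAlgebra ℓ ℓ ℓ) (S : Pred ∣ B ∣ ℓ′) :
               Pred ∣ B ∣ (ℓ ⊔ ℓ′) where
  gen  : ∀ {x} → S x → Generated B S x
  gen∧ : ∀ {x y} → Generated B S x → Generated B S y →
         Generated B S (BooleanAlgebra._∧_ B x y)
  gen∨ : ∀ {x y} → Generated B S x → Generated B S y →
         Generated B S (BooleanAlgebra._∨_ B x y)
  gen¬ : ∀ {x} → Generated B S x → Generated B S (BooleanAlgebra.¬_ B x)
  gen⊤ : Generated B S (BooleanAlgebra.⊤ B)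
  gen⊥ : Generated B S (BooleanAlgebra.⊥ B)
  gen≈ : ∀ {x y} → BooleanAlgebra._≈_ B x y → Generated B S x → Generated B S y

record IsSubalgebra (B : BooleanAlgebra ℓ ℓ ℓ) (S : Pred ∣ B ∣ ℓ) : Set ℓ where
  open BooleanAlgebra B
  field
    ∧-closed : ∀ {x y} → S x → S y → S (x ∧ y)
    ∨-closed : ∀ {x y} → S x → S y → S (x ∨ y)
    ¬-closed : ∀ {x} → S x → S (¬ x)
    ⊤-closed : S ⊤
    ⊥-closed : S ⊥

subalgebra : (B : BooleanAlgebra ℓ ℓ ℓ) (S : Pred ∣ B ∣ ℓ) →
             IsSubalgebra B S → BooleanAlgebra ℓ ℓ ℓ
subalgebra B S closed = record
  { Carrier = ∃ S
  ; _≈_     = λ x y → proj₁ x ≈ proj₁ y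
  ; _≤_     = λ x y → proj₁ x ≤ proj₁ y
  ; _∨_     = λ x y → proj₁ x ∨ proj₁ y , ∨-closed (proj₂ x) (proj₂ y)
  ; _∧_     = λ x y → proj₁ x ∧ proj₁ y , ∧-closed (proj₂ x) (proj₂ y)
  ; ¬_      = λ x → ¬ proj₁ x , ¬-closed (proj₂ x)
  ; ⊤       = ⊤ , ⊤-closed
  ; ⊥       = ⊥ , ⊥-closed
  ; isBooleanAlgebra = record { isHeytingAlgebra = record
    { isBoundedLattice = record
      { isLattice = record
        { isPartialOrder = record
          { isPreorder = record
            { isEquivalence = record { refl = Eq.refl ; sym = Eq.sym ; trans = Eq.trans }
            ; reflexive     = reflexive
            ; trans         = B.trans
            }
          ; antisym = antisym
          }
        ; supremum = λ (x , _) (y , _) → let (l , r , u) = supremum x y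
                                         in l , r , λ (z , _) → u z
        ; infimum  = λ (x , _) (y , _) → let (l , r , u) = infimum x y
                                         in l , r , λ (z , _) → u z
        }
      ; maximum = λ (x , _) → maximum x
      ; minimum = λ (x , _) → minimum x
      }
    ; exponential = λ (w , _) (x , _) (y , _) → exponential w x y
    } }
  }
  where
  module B = BooleanAlgebra B
  open BooleanAlgebra B
  open IsSubalgebra closed

Doctrine : Category o h e → (ℓ : Level) → Set (o ⊔ h ⊔ e ⊔ lsuc ℓ)
Doctrine C ℓ = Functor (op C) (BA ℓ)

module _ {C : Category o h e} (𝒞 : FiniteProducts C) where
  open Category C using (Obj; _⟶_)
  open FiniteProducts 𝒞

  record QAOneStep (P₀ P₁ : Doctrine C ℓ) : Set (o ⊔ h ⊔ e ⊔ ℓ) where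
    private
      module P₀ = Functor P₀
      module P₁ = Functor P₁
      module B₀ X = BooleanAlgebra (P₀.F₀ X)
      module B₁ X = BooleanAlgebra (P₁.F₀ X)
    field
      inj           : NaturalTransformation P₀ P₁
    i : ∀ X → ∣ P₀.F₀ X ∣ → ∣ P₁.F₀ X ∣
    i X = ⟦ NaturalTransformation.η inj X ⟧
    field
      injective     : ∀ X → Injective (B₀._≈_ X) (B₁._≈_ X) (i X)
      All           : ∀ X Y → ∣ P₀.F₀ (X ⊗ Y) ∣ → ∣ P₁.F₀ X ∣
      All-adjoint   : ∀ X Y β α →
                      B₁._≤_ X α (All X Y β) ⇔
                      B₁._≤_ (X ⊗ Y) (⟦ P₁.F₁ π₁ ⟧ α) (i (X ⊗ Y) β)
      beckChevalley : ∀ {X X′} Y (f : X′ ⟶ X) β →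
                      B₁._≈_ X′ (⟦ P₁.F₁ f ⟧ (All X Y β)) (All X′ Y (⟦ P₀.F₁ (f ⊗id) ⟧ β))
      generated     : ∀ X α →
                      Generated (P₁.F₀ X) (λ γ → ∃[ Y ] ∃[ β ] B₁._≈_ X γ (All X Y β)) α

  record QAStratified (ℓ : Level) : Set (o ⊔ h ⊔ e ⊔ lsuc ℓ) where
    field
      𝐏    : ℕ → Doctrine C ℓ
      step : ∀ n → QAOneStep (𝐏 n) (𝐏 (suc n))

    Fibre : ℕ → Obj → BooleanAlgebra ℓ ℓ ℓ
    Fibre n = Functor.F₀ (𝐏 n)

    Equal : ∀ n X → Rel ∣ Fibre n X ∣ ℓ
    Equal n X = BooleanAlgebra._≈_ (Fibre n X)

    reindex : ∀ n {X Y} → X ⟶ Y → ∣ Fibre n Y ∣ → ∣ Fibre n X ∣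
    reindex n f = ⟦ Functor.F₁ (𝐏 n) f ⟧

    module Step n = QAOneStep (step n)

    field
      i-All : ∀ n X Y β → Equal (suc (suc n)) X
              (Step.i (suc n) X (Step.All n X Y β))
              (Step.All (suc n) X Y (Step.i n (X ⊗ Y) β))

module _ {C : Category o h e} {D : Category o′ h′ e′}
         {𝒞 : FiniteProducts C} {𝒟 : FiniteProducts D} where
  private
    module C = Category C
    module 𝒞 = FiniteProducts 𝒞

  record Morphism (P : QAStratified 𝒞 ℓ) (R : QAStratified 𝒟 ℓ) :
                  Set (o ⊔ h ⊔ e ⊔ o′ ⊔ h′ ⊔ e′ ⊔ ℓ) where
    private
      module P = QAStratified P
      module R = QAStratified R
    field
      M         : Functor C D
      preserves : PreservesFiniteProducts 𝒞 𝒟 M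
      𝔪         : ∀ n → NaturalTransformation (P.𝐏 n) (R.𝐏 n ∘F opF M)

    open Functor M using () renaming (F₀ to M₀; F₁ to M₁) public
    open PreservesFiniteProducts preserves using (comparison)

    m : ∀ n X → ∣ P.Fibre n X ∣ → ∣ R.Fibre n (M₀ X) ∣
    m n X = ⟦ NaturalTransformation.η (𝔪 n) X ⟧

    field
      m-i   : ∀ n X α → R.Equal (suc n) (M₀ X)
              (m (suc n) X (P.Step.i n X α))
              (R.Step.i n (M₀ X) (m n X α))
      m-All : ∀ n X Y β → R.Equal (suc n) (M₀ X)
              (m (suc n) X (P.Step.All n X Y β))
              (R.Step.All n (M₀ X) (M₀ Y)
                (R.reindex n (comparison X Y) (m n (X 𝒞.⊗ Y) β)))

-- The composite g ∘ f equals the identity morphism of P: its functor is the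
-- identity on objects and, up to transport along that, on arrows, and its
-- components are identities up to the same transport.
record IsLeftInverse {C : Category o h e} {D : Category o′ h′ e′}
                     {𝒞 : FiniteProducts C} {𝒟 : FiniteProducts D}
                     {P : QAStratified 𝒞 ℓ} {R : QAStratified 𝒟 ℓ}
                     (g : Morphism R P) (f : Morphism P R) : Set (o ⊔ h ⊔ e ⊔ ℓ) where
  private
    module C = Category C
    module P = QAStratified P
    module f = Morphism f
    module g = Morphism g
  field
    on-objects : ∀ X → g.M₀ (f.M₀ X) ≡ X
    on-arrows  : ∀ {X Y} (k : X C.⟶ Y) →
                 subst₂ C._⟶_ (on-objects X) (on-objects Y) (g.M₁ (f.M₁ k)) C.≈ k
    on-fibres  : ∀ n X α → P.Equal n X
                 (subst (λ Z → ∣ P.Fibre n Z ∣) (on-objects X)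
                   (g.m n (f.M₀ X) (f.m n X α)))
                 α

record Isomorphism {C : Category o h e} {D : Category o′ h′ e′}
                   {𝒞 : FiniteProducts C} {𝒟 : FiniteProducts D}
                   (P : QAStratified 𝒞 ℓ) (R : QAStratified 𝒟 ℓ) :
                   Set (o ⊔ h ⊔ e ⊔ o′ ⊔ h′ ⊔ e′ ⊔ ℓ) where
  field
    to       : Morphism P R
    from     : Morphism R P
    from∘to  : IsLeftInverse from to
    to∘from  : IsLeftInverse to from

record Signature (ℓ : Level) : Set (lsuc ℓ) where
  field
    Symbol : Set ℓ
    arity  : Symbol → ℕ

open Signature

-- Contexts and formulas are in well-scoped de Bruijn form.  The context
-- (xₙ₋₁ , … , x₀) is represented by its length n, and its variable xᵢ by the
-- index i, counted from the right.  In particular the context (y⃗ , x) is suc n,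
-- with x at index 0, and (x⃗ , y⃗) with |x⃗| = n and |y⃗| = m is m + n, with y⃗ in
-- the first m indices.  A tuple of terms is listed in the same order as the
-- indices of the context it is a map into.

data Term (𝔽 : Signature ℓ) (n : ℕ) : Set ℓ where
  var : Fin n → Term 𝔽 n
  app : (f : Symbol 𝔽) → Vec (Term 𝔽 n) (arity 𝔽 f) → Term 𝔽 n

module _ {𝔽 : Signature ℓ} where

  infixl 10 _[_]ᵗ _[_]ˢ

  _[_]ᵗ : ∀ {m n} → Term 𝔽 m → Vec (Term 𝔽 n) m → Term 𝔽 n
  _[_]ˢ : ∀ {k m n} → Vec (Term 𝔽 m) k → Vec (Term 𝔽 n) m → Vec (Term 𝔽 n) k

  var i    [ σ ]ᵗ = lookup σ i
  app f ts [ σ ]ᵗ = app f (ts [ σ ]ˢ)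

  []       [ σ ]ˢ = []
  (t ∷ ts) [ σ ]ˢ = t [ σ ]ᵗ ∷ ts [ σ ]ˢ

  idˢ : ∀ {n} → Vec (Term 𝔽 n) n
  idˢ = tabulate var

  wk : ∀ {n} → Vec (Term 𝔽 (suc n)) n
  wk = tabulate (var ∘ suc)

  lift : ∀ {m n} → Vec (Term 𝔽 n) m → Vec (Term 𝔽 (suc n)) (suc m)
  lift σ = var zero ∷ σ [ wk ]ˢ

  proj₁ˢ : ∀ m {n} → Vec (Term 𝔽 (m + n)) n
  proj₁ˢ m = tabulate (var ∘ (m ↑ʳ_))

  proj₂ˢ : ∀ m {n} → Vec (Term 𝔽 (m + n)) m
  proj₂ˢ m {n} = tabulate (var ∘ (_↑ˡ n))

  lookup-[] : ∀ {k m n} (ts : Vec (Term 𝔽 m) k) (σ : Vec (Term 𝔽 n) m) i →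
              lookup (ts [ σ ]ˢ) i ≡ lookup ts i [ σ ]ᵗ
  lookup-[] (t ∷ ts) σ zero    = refl
  lookup-[] (t ∷ ts) σ (suc i) = lookup-[] ts σ i

  tabulate-[] : ∀ {k m n} (g : Fin k → Term 𝔽 m) (σ : Vec (Term 𝔽 n) m) →
                tabulate g [ σ ]ˢ ≡ tabulate (λ i → g i [ σ ]ᵗ)
  tabulate-[] {zero}  g σ = refl
  tabulate-[] {suc k} g σ = cong (g zero [ σ ]ᵗ ∷_) (tabulate-[] (g ∘ suc) σ)

  ++-[] : ∀ {j k m n} (ss : Vec (Term 𝔽 m) j) (ts : Vec (Term 𝔽 m) k) (σ : Vec (Term 𝔽 n) m) →
          (ss ++ ts) [ σ ]ˢ ≡ ss [ σ ]ˢ ++ ts [ σ ]ˢ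
  ++-[] []       ts σ = refl
  ++-[] (s ∷ ss) ts σ = cong (s [ σ ]ᵗ ∷_) (++-[] ss ts σ)

  idˢ-[] : ∀ {m n} (σ : Vec (Term 𝔽 n) m) → idˢ [ σ ]ˢ ≡ σ
  idˢ-[] σ = trans (tabulate-[] var σ) (Vec.tabulate∘lookup σ)

  []ᵗ-id : ∀ {n} (t : Term 𝔽 n) → t [ idˢ ]ᵗ ≡ t
  []ˢ-id : ∀ {k n} (ts : Vec (Term 𝔽 n) k) → ts [ idˢ ]ˢ ≡ ts
  []ᵗ-id (var i)    = Vec.lookup∘tabulate var i
  []ᵗ-id (app f ts) = cong (app f) ([]ˢ-id ts)
  []ˢ-id []         = refl
  []ˢ-id (t ∷ ts)   = cong₂ _∷_ ([]ᵗ-id t) ([]ˢ-id ts)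

  []ᵗ-∘ : ∀ {l m n} (t : Term 𝔽 l) (σ : Vec (Term 𝔽 m) l) (τ : Vec (Term 𝔽 n) m) →
          t [ σ ]ᵗ [ τ ]ᵗ ≡ t [ σ [ τ ]ˢ ]ᵗ
  []ˢ-∘ : ∀ {k l m n} (ts : Vec (Term 𝔽 l) k) (σ : Vec (Term 𝔽 m) l) (τ : Vec (Term 𝔽 n) m) →
          ts [ σ ]ˢ [ τ ]ˢ ≡ ts [ σ [ τ ]ˢ ]ˢ
  []ᵗ-∘ (var i)    σ τ = sym (lookup-[] σ τ i)
  []ᵗ-∘ (app f ts) σ τ = cong (app f) ([]ˢ-∘ ts σ τ)
  []ˢ-∘ []         σ τ = refl
  []ˢ-∘ (t ∷ ts)   σ τ = cong₂ _∷_ ([]ᵗ-∘ t σ τ) ([]ˢ-∘ ts σ τ)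

  wk-∷ : ∀ {m n} (t : Term 𝔽 n) (σ : Vec (Term 𝔽 n) m) → wk [ t ∷ σ ]ˢ ≡ σ
  wk-∷ t σ = trans (tabulate-[] (var ∘ suc) (t ∷ σ)) (Vec.tabulate∘lookup σ)

  lift-∷ : ∀ {l m n} (σ : Vec (Term 𝔽 m) l) (t : Term 𝔽 n) (τ : Vec (Term 𝔽 n) m) →
           lift σ [ t ∷ τ ]ˢ ≡ t ∷ σ [ τ ]ˢ
  lift-∷ σ t τ = cong (t ∷_) (trans ([]ˢ-∘ σ wk (t ∷ τ)) (cong (σ [_]ˢ) (wk-∷ t τ)))

  wk-lift : ∀ {l m n} (ts : Vec (Term 𝔽 l) m) (σ : Vec (Term 𝔽 n) l) →
            ts [ wk ]ˢ [ lift σ ]ˢ ≡ ts [ σ ]ˢ [ wk ]ˢ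
  wk-lift ts σ = trans ([]ˢ-∘ ts wk (lift σ))
    (trans (cong (ts [_]ˢ) (wk-∷ (var zero) (σ [ wk ]ˢ))) (sym ([]ˢ-∘ ts σ wk)))

  lift-∘ : ∀ {l m n} (σ : Vec (Term 𝔽 m) l) (τ : Vec (Term 𝔽 n) m) →
           lift σ [ lift τ ]ˢ ≡ lift (σ [ τ ]ˢ)
  lift-∘ σ τ = cong (var zero ∷_) (wk-lift σ τ)

  lift-id : ∀ {n} → lift (idˢ {n}) ≡ idˢ
  lift-id = cong (var zero ∷_) (idˢ-[] wk)

  proj₁ˢ-++ : ∀ {k m n} (ρ : Vec (Term 𝔽 k) m) (σ : Vec (Term 𝔽 k) n) →
              proj₁ˢ m [ ρ ++ σ ]ˢ ≡ σ
  proj₁ˢ-++ ρ σ = trans (tabulate-[] _ (ρ ++ σ))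
    (trans (Vec.tabulate-cong (Vec.lookup-++ʳ ρ σ)) (Vec.tabulate∘lookup σ))

  proj₂ˢ-++ : ∀ {k m n} (ρ : Vec (Term 𝔽 k) m) (σ : Vec (Term 𝔽 k) n) →
              proj₂ˢ m [ ρ ++ σ ]ˢ ≡ ρ
  proj₂ˢ-++ ρ σ = trans (tabulate-[] _ (ρ ++ σ))
    (trans (Vec.tabulate-cong (Vec.lookup-++ˡ ρ σ)) (Vec.tabulate∘lookup ρ))

  tabulate-++ : ∀ {a} {A : Set a} m {n} (g : Fin (m + n) → A) →
                tabulate (g ∘ (_↑ˡ n)) ++ tabulate (g ∘ (m ↑ʳ_)) ≡ tabulate g
  tabulate-++ zero    g = refl
  tabulate-++ (suc m) g = cong (g zero ∷_) (tabulate-++ m (g ∘ suc))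

  proj-++ : ∀ {k} m {n} (κ : Vec (Term 𝔽 k) (m + n)) →
            proj₂ˢ m [ κ ]ˢ ++ proj₁ˢ m [ κ ]ˢ ≡ κ
  proj-++ m κ = trans (cong₂ _++_ (tabulate-[] (var ∘ (_↑ˡ _)) κ) (tabulate-[] (var ∘ (m ↑ʳ_)) κ))
    (trans (tabulate-++ m (lookup κ)) (Vec.tabulate∘lookup κ))

  tabulate-wk : ∀ {k n} (g : Fin k → Fin n) →
                tabulate (var ∘ g) [ wk ]ˢ ≡ tabulate (var ∘ suc ∘ g)
  tabulate-wk g = trans (tabulate-[] (var ∘ g) wk)
    (Vec.tabulate-cong (λ i → Vec.lookup∘tabulate (var ∘ suc) (g i)))

  liftⁿ : ∀ k {m n} → Vec (Term 𝔽 n) m → Vec (Term 𝔽 (k + n)) (k + m)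
  liftⁿ zero    σ = σ
  liftⁿ (suc k) σ = lift (liftⁿ k σ)

  liftⁿ-proj : ∀ k {m n} (σ : Vec (Term 𝔽 n) m) →
               liftⁿ k σ ≡ proj₂ˢ k ++ σ [ proj₁ˢ k ]ˢ
  liftⁿ-proj zero    σ = sym ([]ˢ-id σ)
  liftⁿ-proj (suc k) σ = cong (var zero ∷_)
    (trans (cong (_[ wk ]ˢ) (liftⁿ-proj k σ))
    (trans (++-[] (proj₂ˢ k) (σ [ proj₁ˢ k ]ˢ) wk)
           (cong₂ _++_ (tabulate-wk (_↑ˡ _))
             (trans ([]ˢ-∘ σ (proj₁ˢ k) wk) (cong (σ [_]ˢ) (tabulate-wk (k ↑ʳ_)))))))

Ctx : Signature ℓ → Category 0ℓ ℓ ℓ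
Ctx 𝔽 = record
  { Obj       = ℕ
  ; _⟶_       = λ n m → Vec (Term 𝔽 n) m
  ; _≈_       = _≡_
  ; id        = idˢ
  ; _∘ᶜ_      = λ τ σ → τ [ σ ]ˢ
  ; ≈-equiv   = isEquivalence
  ; ∘-resp-≈  = cong₂ _[_]ˢ
  ; assoc     = []ˢ-∘
  ; identityˡ = idˢ-[]
  ; identityʳ = []ˢ-id
  }

Ctx-products : (𝔽 : Signature ℓ) → FiniteProducts (Ctx 𝔽)
Ctx-products 𝔽 = record
  { 𝟙          = 0
  ; isTerminal = record { ! = [] ; !-unique = λ { [] → refl } }
  ; _⊗_        = λ n m → m + n
  ; π₁         = λ {_} {m} → proj₁ˢ m
  ; π₂         = λ {_} {m} → proj₂ˢ m
  ; isProduct  = λ {_} {m} → record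
    { ⟨_,_⟩    = λ σ ρ → ρ ++ σ
    ; project₁ = λ σ ρ → proj₁ˢ-++ ρ σ
    ; project₂ = λ σ ρ → proj₂ˢ-++ ρ σ
    ; unique   = λ { κ refl refl → proj-++ m κ }
    }
  }

infixr 6 _⇒′_
infixr 7 _∨′_
infixr 8 _∧′_
infix  9 ¬′_

data Formula (𝔽 ℙ : Signature ℓ) (n : ℕ) : Set ℓ where
  atom      : (p : Symbol ℙ) → Vec (Term 𝔽 n) (arity ℙ p) → Formula 𝔽 ℙ n
  ⊤′ ⊥′     : Formula 𝔽 ℙ n
  _∧′_ _∨′_ : Formula 𝔽 ℙ n → Formula 𝔽 ℙ n → Formula 𝔽 ℙ n
  ¬′_       : Formula 𝔽 ℙ n → Formula 𝔽 ℙ n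
  _⇒′_      : Formula 𝔽 ℙ n → Formula 𝔽 ℙ n → Formula 𝔽 ℙ n
  ∀′ ∃′     : Formula 𝔽 ℙ (suc n) → Formula 𝔽 ℙ n

module _ {𝔽 ℙ : Signature ℓ} where

  infixl 10 _[_]

  _[_] : ∀ {m n} → Formula 𝔽 ℙ m → Vec (Term 𝔽 n) m → Formula 𝔽 ℙ n
  atom p ts [ σ ] = atom p (ts [ σ ]ˢ)
  ⊤′        [ σ ] = ⊤′
  ⊥′        [ σ ] = ⊥′
  (φ ∧′ ψ)  [ σ ] = φ [ σ ] ∧′ ψ [ σ ]
  (φ ∨′ ψ)  [ σ ] = φ [ σ ] ∨′ ψ [ σ ]
  (¬′ φ)    [ σ ] = ¬′ φ [ σ ]
  (φ ⇒′ ψ)  [ σ ] = φ [ σ ] ⇒′ ψ [ σ ]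
  ∀′ φ      [ σ ] = ∀′ (φ [ lift σ ])
  ∃′ φ      [ σ ] = ∃′ (φ [ lift σ ])

  data QuantifierFree {n} : Formula 𝔽 ℙ n → Set ℓ where
    atom : ∀ p ts → QuantifierFree (atom p ts)
    ⊤′   : QuantifierFree ⊤′
    ⊥′   : QuantifierFree ⊥′
    _∧′_ : ∀ {φ ψ} → QuantifierFree φ → QuantifierFree ψ → QuantifierFree (φ ∧′ ψ)
    _∨′_ : ∀ {φ ψ} → QuantifierFree φ → QuantifierFree ψ → QuantifierFree (φ ∨′ ψ)
    ¬′_  : ∀ {φ} → QuantifierFree φ → QuantifierFree (¬′ φ)
    _⇒′_ : ∀ {φ ψ} → QuantifierFree φ → QuantifierFree ψ → QuantifierFree (φ ⇒′ ψ)

  -- ∀ y₁ … ∀ yₘ φ, where (y₁ , … , yₘ) occupies the first m indices.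
  ∀ⁿ : ∀ m {n} → Formula 𝔽 ℙ (m + n) → Formula 𝔽 ℙ n
  ∀ⁿ zero    φ = φ
  ∀ⁿ (suc m) φ = ∀ⁿ m (∀′ φ)

  []-id : ∀ {n} (φ : Formula 𝔽 ℙ n) → φ [ idˢ ] ≡ φ
  []-id (atom p ts) = cong (atom p) ([]ˢ-id ts)
  []-id ⊤′          = refl
  []-id ⊥′          = refl
  []-id (φ ∧′ ψ)    = cong₂ _∧′_ ([]-id φ) ([]-id ψ)
  []-id (φ ∨′ ψ)    = cong₂ _∨′_ ([]-id φ) ([]-id ψ)
  []-id (¬′ φ)      = cong ¬′_ ([]-id φ)
  []-id (φ ⇒′ ψ)    = cong₂ _⇒′_ ([]-id φ) ([]-id ψ)
  []-id (∀′ φ)      = cong ∀′ (trans (cong (φ [_]) lift-id) ([]-id φ))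
  []-id (∃′ φ)      = cong ∃′ (trans (cong (φ [_]) lift-id) ([]-id φ))

  []-∘ : ∀ {l m n} (φ : Formula 𝔽 ℙ l) (σ : Vec (Term 𝔽 m) l) (τ : Vec (Term 𝔽 n) m) →
         φ [ σ ] [ τ ] ≡ φ [ σ [ τ ]ˢ ]
  []-∘ (atom p ts) σ τ = cong (atom p) ([]ˢ-∘ ts σ τ)
  []-∘ ⊤′          σ τ = refl
  []-∘ ⊥′          σ τ = refl
  []-∘ (φ ∧′ ψ)    σ τ = cong₂ _∧′_ ([]-∘ φ σ τ) ([]-∘ ψ σ τ)
  []-∘ (φ ∨′ ψ)    σ τ = cong₂ _∨′_ ([]-∘ φ σ τ) ([]-∘ ψ σ τ)
  []-∘ (¬′ φ)      σ τ = cong ¬′_ ([]-∘ φ σ τ)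
  []-∘ (φ ⇒′ ψ)    σ τ = cong₂ _⇒′_ ([]-∘ φ σ τ) ([]-∘ ψ σ τ)
  []-∘ (∀′ φ)      σ τ = cong ∀′ (trans ([]-∘ φ _ _) (cong (φ [_]) (lift-∘ σ τ)))
  []-∘ (∃′ φ)      σ τ = cong ∃′ (trans ([]-∘ φ _ _) (cong (φ [_]) (lift-∘ σ τ)))

  []-wk-lift : ∀ {m n} (σ : Vec (Term 𝔽 n) m) (φ : Formula 𝔽 ℙ m) →
               φ [ wk ] [ lift σ ] ≡ φ [ σ ] [ wk ]
  []-wk-lift σ φ = trans ([]-∘ φ wk (lift σ))
    (trans (cong (φ [_]) (wk-∷ (var zero) (σ [ wk ]ˢ))) (sym ([]-∘ φ σ wk)))

  []-instance : ∀ {m n} (σ : Vec (Term 𝔽 n) m) (ζ : Formula 𝔽 ℙ (suc m)) (t : Term 𝔽 m) →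
                ζ [ t ∷ idˢ ] [ σ ] ≡ ζ [ lift σ ] [ t [ σ ]ᵗ ∷ idˢ ]
  []-instance σ ζ t = trans ([]-∘ ζ (t ∷ idˢ) σ)
    (trans (cong (λ ρ → ζ [ t [ σ ]ᵗ ∷ ρ ]) (trans (idˢ-[] σ) (sym ([]ˢ-id σ))))
    (trans (cong (ζ [_]) (sym (lift-∷ σ (t [ σ ]ᵗ) idˢ)))
           (sym ([]-∘ ζ (lift σ) (t [ σ ]ᵗ ∷ idˢ)))))

  ∀ⁿ-[] : ∀ k {m n} (φ : Formula 𝔽 ℙ (k + m)) (σ : Vec (Term 𝔽 n) m) →
          ∀ⁿ k φ [ σ ] ≡ ∀ⁿ k (φ [ liftⁿ k σ ])
  ∀ⁿ-[] zero    φ σ = refl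
  ∀ⁿ-[] (suc k) φ σ = ∀ⁿ-[] k (∀′ φ) σ

  QF-[] : ∀ {m n} {φ : Formula 𝔽 ℙ m} (σ : Vec (Term 𝔽 n) m) →
          QuantifierFree φ → QuantifierFree (φ [ σ ])
  QF-[] σ (atom p ts) = atom p (ts [ σ ]ˢ)
  QF-[] σ ⊤′          = ⊤′
  QF-[] σ ⊥′          = ⊥′
  QF-[] σ (q ∧′ r)    = QF-[] σ q ∧′ QF-[] σ r
  QF-[] σ (q ∨′ r)    = QF-[] σ q ∨′ QF-[] σ r
  QF-[] σ (¬′ q)      = ¬′ QF-[] σ q
  QF-[] σ (q ⇒′ r)    = QF-[] σ q ⇒′ QF-[] σ r

Theory : (𝔽 ℙ : Signature ℓ) → Set (lsuc ℓ)
Theory {ℓ} 𝔽 ℙ = Pred (Formula 𝔽 ℙ 0) ℓ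

module _ {𝔽 ℙ : Signature ℓ} where

  infix 3 _∣_⟹_

  -- 𝒯 ∣ Γ ⟹ Δ, for Γ and Δ in context n, is provability of Γ ⇒ Δ from 𝒯 in
  -- that context.  Because of exchange it is immaterial that active formulas
  -- are at the head of both lists.  The left rule for ⊤ and the right rule for
  -- ⊥ are instances of weakening.
  data _∣_⟹_ (𝒯 : Theory 𝔽 ℙ) : ∀ {n} → List (Formula 𝔽 ℙ n) → List (Formula 𝔽 ℙ n) → Set ℓ where
    axiom     : ∀ {φ} → 𝒯 φ → 𝒯 ∣ [] ⟹ φ ∷ []
    identity  : ∀ {n} {φ : Formula 𝔽 ℙ n} → 𝒯 ∣ φ ∷ [] ⟹ φ ∷ []
    weakenL   : ∀ {n} {φ : Formula 𝔽 ℙ n} {Γ Δ} → 𝒯 ∣ Γ ⟹ Δ → 𝒯 ∣ φ ∷ Γ ⟹ Δ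
    weakenR   : ∀ {n} {φ : Formula 𝔽 ℙ n} {Γ Δ} → 𝒯 ∣ Γ ⟹ Δ → 𝒯 ∣ Γ ⟹ φ ∷ Δ
    contractL : ∀ {n} {φ : Formula 𝔽 ℙ n} {Γ Δ} → 𝒯 ∣ φ ∷ φ ∷ Γ ⟹ Δ → 𝒯 ∣ φ ∷ Γ ⟹ Δ
    contractR : ∀ {n} {φ : Formula 𝔽 ℙ n} {Γ Δ} → 𝒯 ∣ Γ ⟹ φ ∷ φ ∷ Δ → 𝒯 ∣ Γ ⟹ φ ∷ Δ
    exchangeL : ∀ {n} {Γ Γ′ Δ : List (Formula 𝔽 ℙ n)} → Γ ↭ Γ′ → 𝒯 ∣ Γ ⟹ Δ → 𝒯 ∣ Γ′ ⟹ Δ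
    exchangeR : ∀ {n} {Γ Δ Δ′ : List (Formula 𝔽 ℙ n)} → Δ ↭ Δ′ → 𝒯 ∣ Γ ⟹ Δ → 𝒯 ∣ Γ ⟹ Δ′
    cut       : ∀ {n} (φ : Formula 𝔽 ℙ n) {Γ Δ} →
                𝒯 ∣ Γ ⟹ φ ∷ Δ → 𝒯 ∣ φ ∷ Γ ⟹ Δ → 𝒯 ∣ Γ ⟹ Δ
    R⊤        : ∀ {n} {Γ Δ : List (Formula 𝔽 ℙ n)} → 𝒯 ∣ Γ ⟹ ⊤′ ∷ Δ
    L⊥        : ∀ {n} {Γ Δ : List (Formula 𝔽 ℙ n)} → 𝒯 ∣ ⊥′ ∷ Γ ⟹ Δ
    L∧        : ∀ {n} {φ ψ : Formula 𝔽 ℙ n} {Γ Δ} →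
                𝒯 ∣ φ ∷ ψ ∷ Γ ⟹ Δ → 𝒯 ∣ φ ∧′ ψ ∷ Γ ⟹ Δ
    R∧        : ∀ {n} {φ ψ : Formula 𝔽 ℙ n} {Γ Δ} →
                𝒯 ∣ Γ ⟹ φ ∷ Δ → 𝒯 ∣ Γ ⟹ ψ ∷ Δ → 𝒯 ∣ Γ ⟹ φ ∧′ ψ ∷ Δ
    L∨        : ∀ {n} {φ ψ : Formula 𝔽 ℙ n} {Γ Δ} →
                𝒯 ∣ φ ∷ Γ ⟹ Δ → 𝒯 ∣ ψ ∷ Γ ⟹ Δ → 𝒯 ∣ φ ∨′ ψ ∷ Γ ⟹ Δ
    R∨        : ∀ {n} {φ ψ : Formula 𝔽 ℙ n} {Γ Δ} →
                𝒯 ∣ Γ ⟹ φ ∷ ψ ∷ Δ → 𝒯 ∣ Γ ⟹ φ ∨′ ψ ∷ Δ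
    L¬        : ∀ {n} {φ : Formula 𝔽 ℙ n} {Γ Δ} → 𝒯 ∣ Γ ⟹ φ ∷ Δ → 𝒯 ∣ ¬′ φ ∷ Γ ⟹ Δ
    R¬        : ∀ {n} {φ : Formula 𝔽 ℙ n} {Γ Δ} → 𝒯 ∣ φ ∷ Γ ⟹ Δ → 𝒯 ∣ Γ ⟹ ¬′ φ ∷ Δ
    L⇒        : ∀ {n} {φ ψ : Formula 𝔽 ℙ n} {Γ Δ} →
                𝒯 ∣ Γ ⟹ φ ∷ Δ → 𝒯 ∣ ψ ∷ Γ ⟹ Δ → 𝒯 ∣ φ ⇒′ ψ ∷ Γ ⟹ Δ
    R⇒        : ∀ {n} {φ ψ : Formula 𝔽 ℙ n} {Γ Δ} →
                𝒯 ∣ φ ∷ Γ ⟹ ψ ∷ Δ → 𝒯 ∣ Γ ⟹ φ ⇒′ ψ ∷ Δ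
    enlarge   : ∀ {n} {Γ Δ : List (Formula 𝔽 ℙ n)} → 𝒯 ∣ Γ ⟹ Δ →
                𝒯 ∣ List.map (_[ wk ]) Γ ⟹ List.map (_[ wk ]) Δ
    L∀        : ∀ {n} {ζ : Formula 𝔽 ℙ (suc n)} {Γ Δ} (t : Term 𝔽 n) →
                𝒯 ∣ ζ [ t ∷ idˢ ] ∷ Γ ⟹ Δ → 𝒯 ∣ ∀′ ζ ∷ Γ ⟹ Δ
    R∀        : ∀ {n} {ζ : Formula 𝔽 ℙ (suc n)} {Γ Δ} →
                𝒯 ∣ List.map (_[ wk ]) Γ ⟹ ζ ∷ List.map (_[ wk ]) Δ → 𝒯 ∣ Γ ⟹ ∀′ ζ ∷ Δ
    L∃        : ∀ {n} {ζ : Formula 𝔽 ℙ (suc n)} {Γ Δ} →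
                𝒯 ∣ ζ ∷ List.map (_[ wk ]) Γ ⟹ List.map (_[ wk ]) Δ → 𝒯 ∣ ∃′ ζ ∷ Γ ⟹ Δ
    R∃        : ∀ {n} {ζ : Formula 𝔽 ℙ (suc n)} {Γ Δ} (t : Term 𝔽 n) →
                𝒯 ∣ Γ ⟹ ζ [ t ∷ idˢ ] ∷ Δ → 𝒯 ∣ Γ ⟹ ∃′ ζ ∷ Δ

module Lindenbaum {𝔽 ℙ : Signature ℓ} (𝒯 : Theory 𝔽 ℙ) where

  private
    map-wk-lift : ∀ {m n} (σ : Vec (Term 𝔽 n) m) (Γ : List (Formula 𝔽 ℙ m)) →
                  List.map (_[ lift σ ]) (List.map (_[ wk ]) Γ) ≡
                  List.map (_[ wk ]) (List.map (_[ σ ]) Γ)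
    map-wk-lift σ Γ = trans (sym (List.map-∘ Γ))
      (trans (List.map-cong ([]-wk-lift σ) Γ) (List.map-∘ Γ))

    map-wk-∷ : ∀ {m n} (t : Term 𝔽 n) (σ : Vec (Term 𝔽 n) m) (Γ : List (Formula 𝔽 ℙ m)) →
               List.map (_[ σ ]) Γ ≡ List.map (_[ t ∷ σ ]) (List.map (_[ wk ]) Γ)
    map-wk-∷ t σ Γ = trans
      (List.map-cong (λ φ → sym (trans ([]-∘ φ wk (t ∷ σ)) (cong (φ [_]) (wk-∷ t σ)))) Γ)
      (List.map-∘ Γ)

    closed-⟹ : ∀ {φ} → 𝒯 ∣ [] ⟹ φ ∷ [] → ∀ {n} (σ : Vec (Term 𝔽 n) 0) →
               𝒯 ∣ [] ⟹ φ [ σ ] ∷ []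
    closed-⟹ {φ} d {zero}  [] = subst (λ ψ → 𝒯 ∣ [] ⟹ ψ ∷ []) (sym ([]-id φ)) d
    closed-⟹ {φ} d {suc n} [] =
      subst (λ ψ → 𝒯 ∣ [] ⟹ ψ ∷ []) ([]-∘ φ [] wk) (enlarge (closed-⟹ d []))

  []-⟹ : ∀ {m n} (σ : Vec (Term 𝔽 n) m) {Γ Δ : List (Formula 𝔽 ℙ m)} →
         𝒯 ∣ Γ ⟹ Δ → 𝒯 ∣ List.map (_[ σ ]) Γ ⟹ List.map (_[ σ ]) Δ
  []-⟹ σ (axiom a)       = closed-⟹ (axiom a) σ
  []-⟹ σ identity        = identity
  []-⟹ σ (weakenL d)     = weakenL ([]-⟹ σ d)
  []-⟹ σ (weakenR d)     = weakenR ([]-⟹ σ d)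
  []-⟹ σ (contractL d)   = contractL ([]-⟹ σ d)
  []-⟹ σ (contractR d)   = contractR ([]-⟹ σ d)
  []-⟹ σ (exchangeL π d) = exchangeL (map⁺ _ π) ([]-⟹ σ d)
  []-⟹ σ (exchangeR π d) = exchangeR (map⁺ _ π) ([]-⟹ σ d)
  []-⟹ σ (cut φ d d′)    = cut (φ [ σ ]) ([]-⟹ σ d) ([]-⟹ σ d′)
  []-⟹ σ R⊤              = R⊤
  []-⟹ σ L⊥              = L⊥
  []-⟹ σ (L∧ d)          = L∧ ([]-⟹ σ d)
  []-⟹ σ (R∧ d d′)       = R∧ ([]-⟹ σ d) ([]-⟹ σ d′)
  []-⟹ σ (L∨ d d′)       = L∨ ([]-⟹ σ d) ([]-⟹ σ d′)
  []-⟹ σ (R∨ d)          = R∨ ([]-⟹ σ d)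
  []-⟹ σ (L¬ d)          = L¬ ([]-⟹ σ d)
  []-⟹ σ (R¬ d)          = R¬ ([]-⟹ σ d)
  []-⟹ σ (L⇒ d d′)       = L⇒ ([]-⟹ σ d) ([]-⟹ σ d′)
  []-⟹ σ (R⇒ d)          = R⇒ ([]-⟹ σ d)
  []-⟹ (t ∷ σ) (enlarge {_} {Γ} {Δ} d) =
    subst₂ (𝒯 ∣_⟹_) (map-wk-∷ t σ Γ) (map-wk-∷ t σ Δ) ([]-⟹ σ d)
  []-⟹ σ (L∀ {ζ = ζ} t d) =
    L∀ (t [ σ ]ᵗ) (subst (λ ξ → 𝒯 ∣ ξ ∷ _ ⟹ _) ([]-instance σ ζ t) ([]-⟹ σ d))
  []-⟹ σ (R∀ {Γ = Γ} {Δ} d) =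
    R∀ (subst₂ (λ Γ Δ → 𝒯 ∣ Γ ⟹ _ ∷ Δ) (map-wk-lift σ Γ) (map-wk-lift σ Δ) ([]-⟹ (lift σ) d))
  []-⟹ σ (L∃ {Γ = Γ} {Δ} d) =
    L∃ (subst₂ (λ Γ Δ → 𝒯 ∣ _ ∷ Γ ⟹ Δ) (map-wk-lift σ Γ) (map-wk-lift σ Δ) ([]-⟹ (lift σ) d))
  []-⟹ σ (R∃ {ζ = ζ} t d) =
    R∃ (t [ σ ]ᵗ) (subst (λ ξ → 𝒯 ∣ _ ⟹ ξ ∷ _) ([]-instance σ ζ t) ([]-⟹ σ d))

  infix 4 _≤ᵀ_ _≈ᵀ_

  _≤ᵀ_ _≈ᵀ_ : ∀ {n} → Rel (Formula 𝔽 ℙ n) ℓ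
  φ ≤ᵀ ψ = 𝒯 ∣ φ ∷ [] ⟹ ψ ∷ []
  φ ≈ᵀ ψ = φ ≤ᵀ ψ × ψ ≤ᵀ φ

  private
    swap₂ : ∀ {n} {φ ψ : Formula 𝔽 ℙ n} {Γ} → φ ∷ ψ ∷ Γ ↭ ψ ∷ φ ∷ Γ
    swap₂ = swap _ _ ↭-refl

    ≤ᵀ-trans : ∀ {n} {φ ψ χ : Formula 𝔽 ℙ n} → φ ≤ᵀ ψ → ψ ≤ᵀ χ → φ ≤ᵀ χ
    ≤ᵀ-trans p q = cut _ (exchangeR swap₂ (weakenR p)) (exchangeL swap₂ (weakenL q))

    ⇨-intro : ∀ {n} (φ ψ χ : Formula 𝔽 ℙ n) → φ ∧′ ψ ≤ᵀ χ → φ ≤ᵀ ¬′ ψ ∨′ χ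
    ⇨-intro φ ψ χ p = R∨ (R¬ (cut (φ ∧′ ψ)
      (R∧ (exchangeR swap₂ (weakenR (weakenL identity)))
          (exchangeR swap₂ (weakenR (exchangeL swap₂ (weakenL identity)))))
      (exchangeL swap₂ (weakenL (exchangeL swap₂ (weakenL p))))))

    ⇨-elim : ∀ {n} (φ ψ χ : Formula 𝔽 ℙ n) → φ ≤ᵀ ¬′ ψ ∨′ χ → φ ∧′ ψ ≤ᵀ χ
    ⇨-elim φ ψ χ p = L∧ (cut (¬′ ψ ∨′ χ)
      (exchangeR swap₂ (weakenR (exchangeL swap₂ (weakenL p))))
      (L∨ (L¬ (exchangeR swap₂ (weakenR (weakenL identity))))
          (exchangeL swap₂ (weakenL (exchangeL swap₂ (weakenL identity))))))

  -- The poset reflection is represented by the setoid of formulas under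
  -- provable equivalence; accordingly InLT n k below is a predicate on formulas
  -- that is invariant under provable equivalence.
  LT-algebra : ℕ → BooleanAlgebra ℓ ℓ ℓ
  LT-algebra n = record
    { Carrier = Formula 𝔽 ℙ n
    ; _≈_     = _≈ᵀ_
    ; _≤_     = _≤ᵀ_
    ; _∨_     = _∨′_
    ; _∧_     = _∧′_
    ; ¬_      = ¬′_
    ; ⊤       = ⊤′
    ; ⊥       = ⊥′
    ; isBooleanAlgebra = record { isHeytingAlgebra = record
      { isBoundedLattice = record
        { isLattice = record
          { isPartialOrder = record
            { isPreorder = record
              { isEquivalence = record
                { refl  = identity , identity
                ; sym   = λ (p , q) → q , p
                ; trans = λ (p , q) (p′ , q′) → ≤ᵀ-trans p p′ , ≤ᵀ-trans q′ q
                }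
              ; reflexive = proj₁
              ; trans     = ≤ᵀ-trans
              }
            ; antisym = _,_
            }
          ; supremum = λ φ ψ → R∨ (exchangeR swap₂ (weakenR identity))
                             , R∨ (weakenR identity)
                             , λ χ → L∨
          ; infimum  = λ φ ψ → L∧ (exchangeL swap₂ (weakenL identity))
                             , L∧ (weakenL identity)
                             , λ χ → R∧
          }
        ; maximum = λ φ → R⊤
        ; minimum = λ φ → L⊥
        }
      ; exponential = λ φ ψ χ → ⇨-intro φ ψ χ , ⇨-elim φ ψ χ
      } }
    }

  private
    ≡⇒≈ᵀ : ∀ {n} {φ ψ : Formula 𝔽 ℙ n} → φ ≡ ψ → φ ≈ᵀ ψ
    ≡⇒≈ᵀ refl = identity , identity

    []-≈ᵀ : ∀ {m n} (σ : Vec (Term 𝔽 n) m) {φ ψ : Formula 𝔽 ℙ m} →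
            φ ≈ᵀ ψ → φ [ σ ] ≈ᵀ ψ [ σ ]
    []-≈ᵀ σ (p , q) = []-⟹ σ p , []-⟹ σ q

    module Alg {n} = BooleanAlgebra (LT-algebra n)

  ∀ⁿ-adjoint : ∀ m {n} (φ : Formula 𝔽 ℙ (m + n)) (ψ : Formula 𝔽 ℙ n) →
               ψ ≤ᵀ ∀ⁿ m φ ⇔ ψ [ proj₁ˢ m ] ≤ᵀ φ
  ∀ⁿ-adjoint zero    φ ψ = mk⇔ (≤ᵀ-trans (proj₁ (≡⇒≈ᵀ ([]-id ψ))))
                               (≤ᵀ-trans (proj₂ (≡⇒≈ᵀ ([]-id ψ))))
  ∀ⁿ-adjoint (suc m) φ ψ = mk⇔
    (λ p → ≤ᵀ-trans (proj₂ (≡⇒≈ᵀ ψ-wk))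
      (≤ᵀ-trans (enlarge (Equivalence.to (∀ⁿ-adjoint m (∀′ φ) ψ) p))
        (L∀ (var zero) (proj₁ (≡⇒≈ᵀ φ-wk)))))
    (λ p → Equivalence.from (∀ⁿ-adjoint m (∀′ φ) ψ)
      (R∀ (≤ᵀ-trans (proj₁ (≡⇒≈ᵀ ψ-wk)) p)))
    where
    ψ-wk : ψ [ proj₁ˢ m ] [ wk ] ≡ ψ [ proj₁ˢ (suc m) ]
    ψ-wk = trans ([]-∘ ψ (proj₁ˢ m) wk) (cong (ψ [_]) (tabulate-wk (m ↑ʳ_)))
    φ-wk : φ [ lift wk ] [ var zero ∷ idˢ ] ≡ φ
    φ-wk = trans ([]-∘ φ (lift wk) (var zero ∷ idˢ))
      (trans (cong (φ [_]) (trans (lift-∷ wk (var zero) idˢ) (cong (var zero ∷_) ([]ˢ-id wk))))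
             ([]-id φ))

  ∀ⁿ-cong : ∀ m {n} {φ ψ : Formula 𝔽 ℙ (m + n)} → φ ≈ᵀ ψ → ∀ⁿ m φ ≈ᵀ ∀ⁿ m ψ
  ∀ⁿ-cong m {φ = φ} {ψ} (p , q) = mono φ ψ p , mono ψ φ q
    where
    mono : ∀ φ ψ → φ ≤ᵀ ψ → ∀ⁿ m φ ≤ᵀ ∀ⁿ m ψ
    mono φ ψ p = Equivalence.from (∀ⁿ-adjoint m ψ (∀ⁿ m φ))
      (≤ᵀ-trans (Equivalence.to (∀ⁿ-adjoint m φ (∀ⁿ m φ)) identity) p)

  InLT : ∀ (n k : ℕ) → Pred (Formula 𝔽 ℙ k) ℓ
  InLT zero    k φ = ∃[ ψ ] QuantifierFree ψ × φ ≈ᵀ ψ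
  InLT (suc n) k   = Generated (LT-algebra k)
                       (λ φ → ∃[ m ] ∃[ α ] InLT n (m + k) α × φ ≈ᵀ ∀ⁿ m α)

  InLT-closed : ∀ n k → IsSubalgebra (LT-algebra k) (InLT n k)
  InLT-closed zero k = record
    { ∧-closed = λ (ψ , q , e) (ψ′ , q′ , e′) → ψ ∧′ ψ′ , q ∧′ q′ , ∧-cong e e′
    ; ∨-closed = λ (ψ , q , e) (ψ′ , q′ , e′) → ψ ∨′ ψ′ , q ∨′ q′ , ∨-cong e e′
    ; ¬-closed = λ (ψ , q , e) → ¬′ ψ , ¬′ q , ¬-cong e
    ; ⊤-closed = ⊤′ , ⊤′ , Alg.Eq.refl
    ; ⊥-closed = ⊥′ , ⊥′ , Alg.Eq.refl
    }
    where open BALaws (LT-algebra k)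
  InLT-closed (suc n) k = record
    { ∧-closed = gen∧
    ; ∨-closed = gen∨
    ; ¬-closed = gen¬
    ; ⊤-closed = gen⊤
    ; ⊥-closed = gen⊥
    }

  private
    ∀ⁿ-[]-proj : ∀ k {m n} (φ : Formula 𝔽 ℙ (k + m)) (σ : Vec (Term 𝔽 n) m) →
                 ∀ⁿ k φ [ σ ] ≡ ∀ⁿ k (φ [ proj₂ˢ k ++ σ [ proj₁ˢ k ]ˢ ])
    ∀ⁿ-[]-proj k φ σ = trans (∀ⁿ-[] k φ σ) (cong (λ ρ → ∀ⁿ k (φ [ ρ ])) (liftⁿ-proj k σ))

  InLT-[] : ∀ n {j k} (σ : Vec (Term 𝔽 k) j) {φ} → InLT n j φ → InLT n k (φ [ σ ])
  InLT-[] zero    σ (ψ , q , e)             = ψ [ σ ] , QF-[] σ q , []-≈ᵀ σ e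
  InLT-[] (suc n) σ (gen (m , α , a , e))   =
    gen (m , _ , InLT-[] n _ a , Alg.Eq.trans ([]-≈ᵀ σ e) (≡⇒≈ᵀ (∀ⁿ-[]-proj m α σ)))
  InLT-[] (suc n) σ (gen∧ a b) = gen∧ (InLT-[] (suc n) σ a) (InLT-[] (suc n) σ b)
  InLT-[] (suc n) σ (gen∨ a b) = gen∨ (InLT-[] (suc n) σ a) (InLT-[] (suc n) σ b)
  InLT-[] (suc n) σ (gen¬ a)   = gen¬ (InLT-[] (suc n) σ a)
  InLT-[] (suc n) σ gen⊤       = gen⊤
  InLT-[] (suc n) σ gen⊥       = gen⊥
  InLT-[] (suc n) σ (gen≈ e a) = gen≈ ([]-≈ᵀ σ e) (InLT-[] (suc n) σ a)

  LTₙ : ℕ → Doctrine (Ctx 𝔽) ℓ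
  LTₙ n = record
    { F₀           = λ k → subalgebra (LT-algebra k) (InLT n k) (InLT-closed n k)
    ; F₁           = λ σ → record
      { ⟦_⟧     = λ (φ , a) → φ [ σ ] , InLT-[] n σ a
      ; ⟦⟧-cong = []-≈ᵀ σ
      ; ∧-homo  = λ _ _ → Alg.Eq.refl
      ; ∨-homo  = λ _ _ → Alg.Eq.refl
      ; ¬-homo  = λ _ → Alg.Eq.refl
      ; ⊤-homo  = Alg.Eq.refl
      ; ⊥-homo  = Alg.Eq.refl
      }
    ; F-resp-≈     = λ { refl _ → Alg.Eq.refl }
    ; identity     = λ (φ , _) → ≡⇒≈ᵀ ([]-id φ)
    ; homomorphism = λ σ τ (φ , _) → ≡⇒≈ᵀ (sym ([]-∘ φ τ σ))
    }

  private
    LT-generated : ∀ n k {φ} (a : InLT (suc n) k φ) →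
                   Generated (Functor.F₀ (LTₙ (suc n)) k)
                     (λ (γ , _) → ∃[ m ] Σ[ β ∈ ∃ (InLT n (m + k)) ] γ ≈ᵀ ∀ⁿ m (proj₁ β))
                     (φ , a)
    LT-generated n k (gen (m , α , a , e)) = gen (m , (α , a) , e)
    LT-generated n k (gen∧ a b) = gen∧ (LT-generated n k a) (LT-generated n k b)
    LT-generated n k (gen∨ a b) = gen∨ (LT-generated n k a) (LT-generated n k b)
    LT-generated n k (gen¬ a)   = gen¬ (LT-generated n k a)
    LT-generated n k gen⊤       = gen⊤
    LT-generated n k gen⊥       = gen⊥
    LT-generated n k (gen≈ e a) = gen≈ e (LT-generated n k a)

    include : ∀ n {k φ} → InLT n k φ → InLT (suc n) k φ
    include n a = gen (0 , _ , a , Alg.Eq.refl)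

    quantify : ∀ n m {k α} → InLT n (m + k) α → InLT (suc n) k (∀ⁿ m α)
    quantify n m a = gen (m , _ , a , Alg.Eq.refl)

  LT-step : ∀ n → QAOneStep (Ctx-products 𝔽) (LTₙ n) (LTₙ (suc n))
  LT-step n = record
    { inj           = record
      { η       = λ k → record
        { ⟦_⟧     = λ (φ , a) → φ , include n a
        ; ⟦⟧-cong = λ e → e
        ; ∧-homo  = λ _ _ → Alg.Eq.refl
        ; ∨-homo  = λ _ _ → Alg.Eq.refl
        ; ¬-homo  = λ _ → Alg.Eq.refl
        ; ⊤-homo  = Alg.Eq.refl
        ; ⊥-homo  = Alg.Eq.refl
        }
      ; commute = λ _ _ → Alg.Eq.refl
      }
    ; injective     = λ _ e → e
    ; All           = λ _ m (α , a) → ∀ⁿ m α , quantify n m a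
    ; All-adjoint   = λ _ m (β , _) (α , _) → ∀ⁿ-adjoint m β α
    ; beckChevalley = λ m σ (β , _) → ≡⇒≈ᵀ (∀ⁿ-[]-proj m β σ)
    ; generated     = λ k (_ , a) → LT-generated n k a
    }

  LT : QAStratified (Ctx-products 𝔽) ℓ
  LT = record
    { 𝐏     = LTₙ
    ; step  = LT-step
    ; i-All = λ _ _ _ _ → Alg.Eq.refl
    }

open Lindenbaum public using (LT)

-- The predicate symbols are the elements of 𝐏 0 and the axioms are the closed
-- formulas valid in the doctrine.  Rather than forming the colimit of the 𝐏 n,
-- every formula is interpreted at every level n, and validity of a formula or a
-- sequent means validity at all sufficiently large n; each application of a
-- quantifier rule just moves to the next level.  The sequent calculus is sound, and
-- it is complete because a formula is provable as soon as its universal closure,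
-- which is an axiom if the formula is valid, is.  Hence "φ denotes α" is an
-- order-preserving and order-reflecting relation between LT n and 𝐏 n compatible
-- with all the structure.  It is total on both sides by induction on n, using that
-- both algebras at n + 1 are generated by quantified elements from level n.

module Submission where

open import Defs
open import Level using (Level)
open import Data.Fin.Base using (zero; _↑ʳ_)
open import Data.List.Base as List using (List; []; _∷_; foldr)
open import Data.List.Relation.Binary.Permutation.Propositional using (_↭_; prep; swap; ↭-refl)
import Data.List.Relation.Binary.Permutation.Propositional as ↭
open import Data.Nat.Base as ℕ using (ℕ; zero; suc; _+_; _⊔_; s≤s; _≤′_; ≤′-refl; ≤′-step)
import Data.Nat.Properties as ℕ
open import Data.Product.Base using (∃; ∃-syntax; Σ-syntax; _×_; _,_; proj₁; proj₂)
open import Data.Vec.Base using (Vec; []; _∷_)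
open import Function.Base using (_∘_)
open import Function.Bundles using (_⇔_; mk⇔; Equivalence)
open import Relation.Binary.Lattice.Bundles using (BooleanAlgebra)
import Relation.Binary.Lattice.Properties.DistributiveLattice as DistributiveLattice
import Relation.Binary.Lattice.Properties.HeytingAlgebra as HeytingAlgebra
import Relation.Binary.Lattice.Properties.JoinSemilattice as JoinSemilattice
import Relation.Binary.Lattice.Properties.MeetSemilattice as MeetSemilattice
open import Relation.Binary.PropositionalEquality.Core using (_≡_; refl; sym; trans; cong; subst)

-- Properties of all sufficiently large levels.

∀ᶠ : ∀ {a} → (ℕ → Set a) → Set a
∀ᶠ Q = ∃[ K ] (∀ N → K ℕ.≤ N → Q N)

module _ {a} {Q : ℕ → Set a} where

  always : (∀ N → Q N) → ∀ᶠ Q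
  always q = 0 , λ N _ → q N

  -- Quantified values live at successor levels. Raising the bound by one keeps level zero, where
  -- they are only defaults, out of range.
  ∀ᶠ-suc⁺ : ∀ᶠ (Q ∘ suc) → ∀ᶠ Q
  ∀ᶠ-suc⁺ (K , q) = suc K , λ { (suc N) (s≤s K≤N) → q N K≤N }

  ∀ᶠ-suc⁻ : ∀ᶠ Q → ∀ᶠ (Q ∘ suc)
  ∀ᶠ-suc⁻ (K , q) = K , λ N K≤N → q (suc N) (ℕ.m≤n⇒m≤1+n K≤N)

module _ {a b} {Q : ℕ → Set a} {R : ℕ → Set b} where

  ∀ᶠ-map : (∀ {N} → Q N → R N) → ∀ᶠ Q → ∀ᶠ R
  ∀ᶠ-map f (K , q) = K , λ N K≤N → f (q N K≤N)

  ∀ᶠ-zip : ∀ {c} {S : ℕ → Set c} → (∀ {N} → Q N → R N → S N) → ∀ᶠ Q → ∀ᶠ R → ∀ᶠ S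
  ∀ᶠ-zip f (K , q) (L , r) = K ⊔ L , λ N K⊔L≤N →
    f (q N (ℕ.m⊔n≤o⇒m≤o K L K⊔L≤N)) (r N (ℕ.m⊔n≤o⇒n≤o K L K⊔L≤N))

-- Sequent rules as inequalities in a Boolean algebra.

module Calculus {ℓ} (B : BooleanAlgebra ℓ ℓ ℓ) where
  open BooleanAlgebra B renaming (trans to ≤-trans; refl to ≤-refl)
  open HeytingAlgebra heytingAlgebra using (swap-transpose-⇨; y≤x⇨y; distributiveLattice)
  open DistributiveLattice distributiveLattice using (∨-distribʳ-∧)
  open JoinSemilattice joinSemilattice using (∨-assoc)
  open MeetSemilattice meetSemilattice using (∧-assoc)
  open BALaws B public

  private
    variable
      g d x y : Carrier

  -- Both `x` and `d` lie below the implication from `g` to `d`, hence so does `g`.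
  cutᴮ : g ≤ x ∨ d → x ∧ g ≤ d → g ≤ d
  cutᴮ p q = ≤-trans (∧-greatest ≤-refl ≤-refl)
    (transpose-∧ (≤-trans p (∨-least (transpose-⇨ q) y≤x⇨y)))

  R∧ᴮ : g ≤ x ∨ d → g ≤ y ∨ d → g ≤ (x ∧ y) ∨ d
  R∧ᴮ p q = ≤-trans (∧-greatest p q) (reflexive (Eq.sym (∨-distribʳ-∧ _ _ _)))

  L∨ᴮ : x ∧ g ≤ d → y ∧ g ≤ d → (x ∨ y) ∧ g ≤ d
  L∨ᴮ p q = transpose-∧ (∨-least (transpose-⇨ p) (transpose-⇨ q))

  R¬ᴮ : x ∧ g ≤ d → g ≤ ¬ x ∨ d
  R¬ᴮ = swap-transpose-⇨

  L¬ᴮ : g ≤ x ∨ d → ¬ x ∧ g ≤ d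
  L¬ᴮ p = cutᴮ (≤-trans (x∧y≤y _ _) p)
    (≤-trans (∧-greatest (≤-trans (x∧y≤y _ _) (x∧y≤x _ _)) (x∧y≤x _ _))
      (≤-trans (transpose-∧ (x≤x∨y _ ⊥)) (minimum _)))

  -- A cut on `¬ x`: its first premise is excluded middle, its second the hypothesis weakened by
  -- `x`.
  R¬ᴮ⁻ : ¬ x ∧ g ≤ d → g ≤ x ∨ d
  R¬ᴮ⁻ p = cutᴮ (R¬ᴮ (≤-trans (x∧y≤x _ _) (x≤x∨y _ _))) (≤-trans p (y≤x∨y _ _))

  L∧ᴮ : x ∧ (y ∧ g) ≤ d → (x ∧ y) ∧ g ≤ d
  L∧ᴮ = ≤-trans (reflexive (∧-assoc _ _ _))

  R∨ᴮ : g ≤ x ∨ (y ∨ d) → g ≤ (x ∨ y) ∨ d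
  R∨ᴮ p = ≤-trans p (reflexive (Eq.sym (∨-assoc _ _ _)))

  ∧-swap : x ∧ (y ∧ g) ≤ y ∧ (x ∧ g)
  ∧-swap = ∧-greatest (≤-trans (x∧y≤y _ _) (x∧y≤x _ _))
    (∧-mono ≤-refl (x∧y≤y _ _))

  ∨-swap : x ∨ (y ∨ d) ≤ y ∨ (x ∨ d)
  ∨-swap = ∨-least (≤-trans (x≤x∨y _ _) (y≤x∨y _ _))
    (∨-mono ≤-refl (y≤x∨y _ _))

-- Boolean homomorphisms and the order.

module _ {ℓ} {A B : BooleanAlgebra ℓ ℓ ℓ} (f : BooleanHomomorphism A B) where
  private
    module A = BooleanAlgebra A
    module B = BooleanAlgebra B
  open BooleanHomomorphism f

  ⟦⟧-mono : ∀ {x y} → x A.≤ y → ⟦ x ⟧ B.≤ ⟦ y ⟧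
  ⟦⟧-mono {x} {y} p = B.trans
    (B.reflexive (B.Eq.trans (⟦⟧-cong (A.antisym (A.∧-greatest A.refl p) (A.x∧y≤x _ _))) (∧-homo x y)))
    (B.x∧y≤y _ _)

  -- The inequality amounts to the equation of `x` with `x ∧ y`, and injectivity reflects equations.
  ⟦⟧-reflects-≤ : (∀ {x y} → ⟦ x ⟧ B.≈ ⟦ y ⟧ → x A.≈ y) → ∀ {x y} → ⟦ x ⟧ B.≤ ⟦ y ⟧ → x A.≤ y
  ⟦⟧-reflects-≤ injective {x} {y} p = A.trans
    (A.reflexive (injective (B.Eq.trans (B.antisym (B.∧-greatest B.refl p) (B.x∧y≤x _ _))
                                        (B.Eq.sym (∧-homo x y)))))
    (A.x∧y≤y _ _)

-- Reindexing and quantifiers in the doctrine.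

module InternalLogic {ℓ} {𝔽 : Signature ℓ} (P : QAStratified (Ctx-products 𝔽) ℓ) where
  open QAStratified P using (𝐏; Fibre; reindex; module Step; i-All)

  open module B {n X} = BooleanAlgebra (Fibre n X) public
    renaming (trans to ≤-trans; refl to ≤-refl)
  open module C {n X} = Calculus (Fibre n X) public

  Elt : ℕ → ℕ → Set ℓ
  Elt n X = ∣ Fibre n X ∣

  i : ∀ {n X} → Elt n X → Elt (suc n) X
  i = Step.i _ _

  All : ∀ {n X} m → Elt n (m + X) → Elt (suc n) X
  All m = Step.All _ _ m

  module I {n X} = BooleanHomomorphism (NaturalTransformation.η (Step.inj n) X)
  module R {n X Y} (σ : Vec (Term 𝔽 X) Y) = BooleanHomomorphism (Functor.F₁ (𝐏 n) σ)

  infix 9 _*_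
  _*_ : ∀ {n X Y} → Vec (Term 𝔽 X) Y → Elt n Y → Elt n X
  σ * a = reindex _ σ a

  i-mono : ∀ {n X} {a b : Elt n X} → a ≤ b → i a ≤ i b
  i-mono = ⟦⟧-mono (NaturalTransformation.η (Step.inj _) _)

  i-reflects-≤ : ∀ {n X} {a b : Elt n X} → i a ≤ i b → a ≤ b
  i-reflects-≤ = ⟦⟧-reflects-≤ (NaturalTransformation.η (Step.inj _) _) (Step.injective _ _)

  *-mono : ∀ {n X Y} (σ : Vec (Term 𝔽 X) Y) {a b : Elt n Y} → a ≤ b → σ * a ≤ σ * b
  *-mono σ = ⟦⟧-mono (Functor.F₁ (𝐏 _) σ)

  *-≡ : ∀ {n X Y} {σ τ : Vec (Term 𝔽 X) Y} → σ ≡ τ → (a : Elt n Y) → σ * a ≈ τ * a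
  *-≡ refl a = Eq.refl

  *-id : ∀ {n X} (a : Elt n X) → idˢ * a ≈ a
  *-id = Functor.identity (𝐏 _)

  *-∘ : ∀ {n X Y Z} (τ : Vec (Term 𝔽 Y) Z) (σ : Vec (Term 𝔽 X) Y) (a : Elt n Z) →
        (τ [ σ ]ˢ) * a ≈ σ * (τ * a)
  *-∘ τ σ = Functor.homomorphism (𝐏 _) σ τ

  i-* : ∀ {n X Y} (σ : Vec (Term 𝔽 X) Y) (a : Elt n Y) → i (σ * a) ≈ σ * i a
  i-* = NaturalTransformation.commute (Step.inj _)

  All-from : ∀ {n X} m {b : Elt n (m + X)} {a} → proj₁ˢ m * a ≤ i b → a ≤ All m b
  All-from m = Equivalence.from (Step.All-adjoint _ _ m _ _)

  All-to : ∀ {n X} m {b : Elt n (m + X)} {a} → a ≤ All m b → proj₁ˢ m * a ≤ i b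
  All-to m = Equivalence.to (Step.All-adjoint _ _ m _ _)

  All-mono : ∀ {n X} m {b c : Elt n (m + X)} → b ≤ c → All m b ≤ All m c
  All-mono m p = All-from m (≤-trans (All-to m ≤-refl) (i-mono p))

  All-cong : ∀ {n X} m {b c : Elt n (m + X)} → b ≈ c → All m b ≈ All m c
  All-cong m p = antisym (All-mono m (reflexive p)) (All-mono m (reflexive (Eq.sym p)))

  All-i : ∀ {n X} m (b : Elt n (m + X)) → i (All m b) ≈ All m (i b)
  All-i m = i-All _ _ m

  -- `proj₁ˢ 0` is the identity substitution, so the adjunction along it leaves only `i`.
  All-zero : ∀ {n X} (b : Elt n X) → All 0 b ≈ i b
  All-zero b = antisym
    (≤-trans (reflexive (Eq.sym (*-id _))) (All-to 0 ≤-refl))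
    (All-from 0 (reflexive (*-id _)))

  proj₁ˢ-suc : ∀ m {X} → proj₁ˢ m [ proj₁ˢ 1 ]ˢ ≡ proj₁ˢ {𝔽 = 𝔽} (suc m) {X}
  proj₁ˢ-suc m = tabulate-wk (m ↑ʳ_)

  -- Quantifying a block at once costs one level, one variable at a time costs one
  -- level per variable; the two agree once both are brought to the same level.
  All-suc : ∀ {n X} m (b : Elt n (suc m + X)) → All m (All 1 b) ≈ All (suc m) (i b)
  All-suc m b = antisym
    (All-from (suc m) (≤-trans (reflexive (Eq.trans (*-≡ (sym (proj₁ˢ-suc m)) _) (*-∘ _ _ _)))
      (All-to 1 (≤-trans (All-to m ≤-refl) (reflexive (All-i 1 b))))))
    (All-from m (≤-trans
      (All-from 1 (≤-trans
        (reflexive (Eq.trans (Eq.sym (*-∘ _ _ _)) (*-≡ (proj₁ˢ-suc m) _)))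
        (All-to (suc m) ≤-refl)))
      (reflexive (Eq.sym (All-i 1 b)))))

  -- Beck-Chevalley, once `lift σ` is recognised as the product of `σ` with an identity.
  All-lift : ∀ {n X Y} (σ : Vec (Term 𝔽 X) Y) (b : Elt n (suc Y)) →
             σ * All 1 b ≈ All 1 (lift σ * b)
  All-lift σ b = Eq.trans (Step.beckChevalley _ 1 σ b)
    (All-cong 1 (*-≡ (sym (liftⁿ-proj 1 σ)) b))

  -- The adjunction has no room for side formulas on the right, so `d` is moved to the left as `¬ d`
  -- and moved back afterwards.
  R∀ᴮ : ∀ {n X} {b : Elt n (suc X)} {g d} → wk * g ≤ i b ∨ wk * d → g ≤ All 1 b ∨ d
  R∀ᴮ {d = d} p = ≤-trans (R¬ᴮ⁻ (All-from 1 (≤-trans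
    (reflexive (Eq.trans (R.∧-homo wk _ _) (∧-cong (R.¬-homo wk d) Eq.refl)))
    (L¬ᴮ (≤-trans p (∨-least (y≤x∨y _ _) (x≤x∨y _ _))))))) (∨-least (y≤x∨y _ _) (x≤x∨y _ _))

  -- Reindex the counit of the adjunction along `t ∷ idˢ`, which `wk` sends back to the identity.
  -- The counit lives one level above `b`, whence the `i`.
  All-instance : ∀ {n X} (b : Elt n (suc X)) (t : Term 𝔽 X) → All 1 b ≤ (t ∷ idˢ) * i b
  All-instance b t = ≤-trans
    (reflexive (Eq.sym (Eq.trans (Eq.sym (*-∘ wk (t ∷ idˢ) _))
      (Eq.trans (*-≡ (wk-∷ t idˢ) _) (*-id _)))))
    (*-mono (t ∷ idˢ) (All-to 1 ≤-refl))

  -- An element of the colimit of the 𝐏 n is presented as a section that is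
  -- eventually stable; Stable n s says that s is such a section from level n on.
  Section : ℕ → Set ℓ
  Section X = ∀ n → Elt n X

  Stable : ∀ {X} → ℕ → Section X → Set ℓ
  Stable n s = ∀ N → n ℕ.≤ N → i (s N) ≈ s (suc N)

  -- The language and the interpretation of formulas.

  ℙ : Signature ℓ
  ℙ = record { Symbol = Σ[ k ∈ ℕ ] Elt 0 k ; arity = proj₁ }

  ι : ∀ {X} → Elt 0 X → Section X
  ι a zero    = a
  ι a (suc n) = i (ι a n)

  -- A quantifier raises the level, so at level 0 a quantified formula gets the
  -- junk value ⊤ or ⊥; only the values at large levels matter.
  ⟦_⟧ : ∀ {X} → Formula 𝔽 ℙ X → Section X
  ⟦ atom (k , a) ts ⟧ n = ts * ι a n
  ⟦ ⊤′ ⟧     n       = ⊤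
  ⟦ ⊥′ ⟧     n       = ⊥
  ⟦ φ ∧′ ψ ⟧ n       = ⟦ φ ⟧ n ∧ ⟦ ψ ⟧ n
  ⟦ φ ∨′ ψ ⟧ n       = ⟦ φ ⟧ n ∨ ⟦ ψ ⟧ n
  ⟦ ¬′ φ ⟧   n       = ¬ ⟦ φ ⟧ n
  ⟦ φ ⇒′ ψ ⟧ n       = ¬ ⟦ φ ⟧ n ∨ ⟦ ψ ⟧ n
  ⟦ ∀′ φ ⟧   zero    = ⊤
  ⟦ ∀′ φ ⟧   (suc n) = All 1 (⟦ φ ⟧ n)
  ⟦ ∃′ φ ⟧   zero    = ⊥
  ⟦ ∃′ φ ⟧   (suc n) = ¬ All 1 (¬ ⟦ φ ⟧ n)

  -- This holds at every level, not just eventually: Beck-Chevalley relates values at one and the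
  -- same level, and reindexing preserves the defaults at level zero.
  ⟦⟧-[] : ∀ {X Y} (φ : Formula 𝔽 ℙ Y) (σ : Vec (Term 𝔽 X) Y) n → ⟦ φ [ σ ] ⟧ n ≈ σ * ⟦ φ ⟧ n
  ⟦⟧-[] (atom p ts) σ n = *-∘ ts σ _
  ⟦⟧-[] ⊤′ σ n = Eq.sym (R.⊤-homo σ)
  ⟦⟧-[] ⊥′ σ n = Eq.sym (R.⊥-homo σ)
  ⟦⟧-[] (φ ∧′ ψ) σ n = Eq.trans (∧-cong (⟦⟧-[] φ σ n) (⟦⟧-[] ψ σ n)) (Eq.sym (R.∧-homo σ _ _))
  ⟦⟧-[] (φ ∨′ ψ) σ n = Eq.trans (∨-cong (⟦⟧-[] φ σ n) (⟦⟧-[] ψ σ n)) (Eq.sym (R.∨-homo σ _ _))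
  ⟦⟧-[] (¬′ φ)   σ n = Eq.trans (¬-cong (⟦⟧-[] φ σ n)) (Eq.sym (R.¬-homo σ _))
  ⟦⟧-[] (φ ⇒′ ψ) σ n = Eq.trans
    (∨-cong (Eq.trans (¬-cong (⟦⟧-[] φ σ n)) (Eq.sym (R.¬-homo σ _))) (⟦⟧-[] ψ σ n))
    (Eq.sym (R.∨-homo σ _ _))
  ⟦⟧-[] (∀′ φ) σ zero    = Eq.sym (R.⊤-homo σ)
  ⟦⟧-[] (∀′ φ) σ (suc n) = Eq.trans (All-cong 1 (⟦⟧-[] φ (lift σ) n)) (Eq.sym (All-lift σ _))
  ⟦⟧-[] (∃′ φ) σ zero    = Eq.sym (R.⊥-homo σ)
  ⟦⟧-[] (∃′ φ) σ (suc n) = Eq.trans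
    (¬-cong (Eq.trans
      (All-cong 1 (Eq.trans (¬-cong (⟦⟧-[] φ (lift σ) n)) (Eq.sym (R.¬-homo (lift σ) _))))
      (Eq.sym (All-lift σ _))))
    (Eq.sym (R.¬-homo σ _))

  i-∧ : ∀ {n X} {a b : Elt n X} {a′ b′} → i a ≈ a′ → i b ≈ b′ → i (a ∧ b) ≈ a′ ∧ b′
  i-∧ p q = Eq.trans (I.∧-homo _ _) (∧-cong p q)

  i-∨ : ∀ {n X} {a b : Elt n X} {a′ b′} → i a ≈ a′ → i b ≈ b′ → i (a ∨ b) ≈ a′ ∨ b′
  i-∨ p q = Eq.trans (I.∨-homo _ _) (∨-cong p q)

  i-¬ : ∀ {n X} {a : Elt n X} {a′} → i a ≈ a′ → i (¬ a) ≈ ¬ a′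
  i-¬ p = Eq.trans (I.¬-homo _) (¬-cong p)

  i-All-cong : ∀ {n X} m {a : Elt n (m + X)} {a′} → i a ≈ a′ → i (All m a) ≈ All m a′
  i-All-cong m p = Eq.trans (All-i m _) (All-cong m p)

  -- `i` commutes with the Boolean operations, with reindexing and, by `i-All`, with quantifiers.
  -- Each quantifier raises the bound by one to skip its default value.
  ⟦⟧-stable : ∀ {X} (φ : Formula 𝔽 ℙ X) → ∀ᶠ λ n → i (⟦ φ ⟧ n) ≈ ⟦ φ ⟧ (suc n)
  ⟦⟧-stable (atom p ts) = always λ n → i-* ts _
  ⟦⟧-stable ⊤′       = always λ n → I.⊤-homo
  ⟦⟧-stable ⊥′       = always λ n → I.⊥-homo
  ⟦⟧-stable (φ ∧′ ψ) = ∀ᶠ-zip i-∧ (⟦⟧-stable φ) (⟦⟧-stable ψ)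
  ⟦⟧-stable (φ ∨′ ψ) = ∀ᶠ-zip i-∨ (⟦⟧-stable φ) (⟦⟧-stable ψ)
  ⟦⟧-stable (¬′ φ)   = ∀ᶠ-map i-¬ (⟦⟧-stable φ)
  ⟦⟧-stable (φ ⇒′ ψ) = ∀ᶠ-zip (λ p q → i-∨ (i-¬ p) q) (⟦⟧-stable φ) (⟦⟧-stable ψ)
  ⟦⟧-stable (∀′ φ)   = ∀ᶠ-suc⁺ (∀ᶠ-map (i-All-cong 1) (⟦⟧-stable φ))
  ⟦⟧-stable (∃′ φ)   = ∀ᶠ-suc⁺ (∀ᶠ-map (i-¬ ∘ i-All-cong 1 ∘ i-¬) (⟦⟧-stable φ))

  ⟦∀ⁿ⟧ : ∀ m {X} (φ : Formula 𝔽 ℙ (m + X)) → ∀ᶠ λ n → ⟦ ∀ⁿ m φ ⟧ (suc n) ≈ All m (⟦ φ ⟧ n)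
  ⟦∀ⁿ⟧ zero    φ = ∀ᶠ-map (λ p → Eq.trans (Eq.sym p) (Eq.sym (All-zero _))) (⟦⟧-stable φ)
  -- Merging the innermost quantifier into the block by `All-suc` leaves an `i` on the value of `φ`;
  -- stability absorbs it.
  ⟦∀ⁿ⟧ (suc m) φ = ∀ᶠ-suc⁺ (∀ᶠ-zip
    (λ p q → Eq.trans p (Eq.trans (All-suc m _) (All-cong (suc m) q)))
    (∀ᶠ-suc⁻ (⟦∀ⁿ⟧ m (∀′ φ))) (⟦⟧-stable φ))

  Valid : ∀ {X} → Formula 𝔽 ℙ X → Set ℓ
  Valid φ = ∀ᶠ λ n → ⊤ ≤ ⟦ φ ⟧ n

  𝒯 : Theory 𝔽 ℙ
  𝒯 = Valid

  -- Soundness of the sequent calculus.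

  ⋀ ⋁ : ∀ {X} → List (Formula 𝔽 ℙ X) → Section X
  ⋀ Γ n = foldr (λ φ g → ⟦ φ ⟧ n ∧ g) ⊤ Γ
  ⋁ Δ n = foldr (λ φ d → ⟦ φ ⟧ n ∨ d) ⊥ Δ

  ⋀-[] : ∀ {X Y} (Γ : List (Formula 𝔽 ℙ Y)) (σ : Vec (Term 𝔽 X) Y) n →
         ⋀ (List.map (_[ σ ]) Γ) n ≈ σ * ⋀ Γ n
  ⋀-[] []      σ n = Eq.sym (R.⊤-homo σ)
  ⋀-[] (φ ∷ Γ) σ n = Eq.trans (∧-cong (⟦⟧-[] φ σ n) (⋀-[] Γ σ n)) (Eq.sym (R.∧-homo σ _ _))

  ⋁-[] : ∀ {X Y} (Δ : List (Formula 𝔽 ℙ Y)) (σ : Vec (Term 𝔽 X) Y) n →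
         ⋁ (List.map (_[ σ ]) Δ) n ≈ σ * ⋁ Δ n
  ⋁-[] []      σ n = Eq.sym (R.⊥-homo σ)
  ⋁-[] (φ ∷ Δ) σ n = Eq.trans (∨-cong (⟦⟧-[] φ σ n) (⋁-[] Δ σ n)) (Eq.sym (R.∨-homo σ _ _))

  ⋀-↭ : ∀ {X} {Γ Γ′ : List (Formula 𝔽 ℙ X)} → Γ ↭ Γ′ → ∀ {n} → ⋀ Γ n ≤ ⋀ Γ′ n
  ⋀-↭ ↭.refl        = ≤-refl
  ⋀-↭ (prep φ π)    = ∧-mono ≤-refl (⋀-↭ π)
  ⋀-↭ (swap φ ψ π)  = ≤-trans ∧-swap (∧-mono ≤-refl (∧-mono ≤-refl (⋀-↭ π)))
  ⋀-↭ (↭.trans π ρ) = ≤-trans (⋀-↭ π) (⋀-↭ ρ)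

  ⋁-↭ : ∀ {X} {Δ Δ′ : List (Formula 𝔽 ℙ X)} → Δ ↭ Δ′ → ∀ {n} → ⋁ Δ n ≤ ⋁ Δ′ n
  ⋁-↭ ↭.refl        = ≤-refl
  ⋁-↭ (prep φ π)    = ∨-mono ≤-refl (⋁-↭ π)
  ⋁-↭ (swap φ ψ π)  = ≤-trans ∨-swap (∨-mono ≤-refl (∨-mono ≤-refl (⋁-↭ π)))
  ⋁-↭ (↭.trans π ρ) = ≤-trans (⋁-↭ π) (⋁-↭ ρ)

  instance-≤ : ∀ {n X} (ζ : Formula 𝔽 ℙ (suc X)) (t : Term 𝔽 X) →
               i (⟦ ζ ⟧ n) ≈ ⟦ ζ ⟧ (suc n) → All 1 (⟦ ζ ⟧ n) ≤ ⟦ ζ [ t ∷ idˢ ] ⟧ (suc n)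
  instance-≤ ζ t p = ≤-trans (All-instance _ t)
    (reflexive (Eq.trans (R.⟦⟧-cong (t ∷ idˢ) p) (Eq.sym (⟦⟧-[] ζ (t ∷ idˢ) _))))

  soundness : ∀ {X} {Γ Δ : List (Formula 𝔽 ℙ X)} → 𝒯 ∣ Γ ⟹ Δ → ∀ᶠ λ n → ⋀ Γ n ≤ ⋁ Δ n
  soundness (axiom v)       = ∀ᶠ-map (λ p → ≤-trans p (x≤x∨y _ _)) v
  soundness identity        = always λ n → ≤-trans (x∧y≤x _ _) (x≤x∨y _ _)
  soundness (weakenL d)     = ∀ᶠ-map (≤-trans (x∧y≤y _ _)) (soundness d)
  soundness (weakenR d)     = ∀ᶠ-map (λ p → ≤-trans p (y≤x∨y _ _)) (soundness d)
  soundness (contractL d)   = ∀ᶠ-map (≤-trans (∧-greatest (x∧y≤x _ _) ≤-refl)) (soundness d)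
  soundness (contractR d)   = ∀ᶠ-map (λ p → ≤-trans p (∨-least (x≤x∨y _ _) ≤-refl)) (soundness d)
  soundness (exchangeL π d) = ∀ᶠ-map (≤-trans (⋀-↭ (↭.↭-sym π))) (soundness d)
  soundness (exchangeR π d) = ∀ᶠ-map (λ p → ≤-trans p (⋁-↭ π)) (soundness d)
  soundness (cut φ d e)     = ∀ᶠ-zip cutᴮ (soundness d) (soundness e)
  soundness R⊤              = always λ n → ≤-trans (maximum _) (x≤x∨y _ _)
  soundness L⊥              = always λ n → ≤-trans (x∧y≤x _ _) (minimum _)
  soundness (L∧ d)          = ∀ᶠ-map L∧ᴮ (soundness d)
  soundness (R∧ d e)        = ∀ᶠ-zip R∧ᴮ (soundness d) (soundness e)
  soundness (L∨ d e)        = ∀ᶠ-zip L∨ᴮ (soundness d) (soundness e)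
  soundness (R∨ d)          = ∀ᶠ-map R∨ᴮ (soundness d)
  soundness (L¬ d)          = ∀ᶠ-map L¬ᴮ (soundness d)
  soundness (R¬ d)          = ∀ᶠ-map R¬ᴮ (soundness d)
  soundness (L⇒ d e)        = ∀ᶠ-zip (λ p q → L∨ᴮ (L¬ᴮ p) q) (soundness d) (soundness e)
  soundness (R⇒ d)          = ∀ᶠ-map (R∨ᴮ ∘ R¬ᴮ) (soundness d)
  soundness (enlarge {Γ = Γ} {Δ} d) = ∀ᶠ-map
    (λ p → ≤-trans (reflexive (⋀-[] Γ wk _))
      (≤-trans (*-mono wk p) (reflexive (Eq.sym (⋁-[] Δ wk _)))))
    (soundness d)
  -- The quantified formula at level `suc n` is computed from `ζ` at level `n`, its instance from
  -- `ζ` at level `suc n`. Stability of `ζ` bridges the two, and likewise in the other quantifier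
  -- rules.
  soundness (L∀ {ζ = ζ} t d) = ∀ᶠ-suc⁺ (∀ᶠ-zip
    (λ p s → ≤-trans (∧-mono (instance-≤ ζ t s) ≤-refl) p)
    (∀ᶠ-suc⁻ (soundness d)) (⟦⟧-stable ζ))
  soundness (R∀ {ζ = ζ} {Γ} {Δ} d) = ∀ᶠ-suc⁺ (∀ᶠ-zip
    (λ p s → R∀ᴮ (≤-trans (reflexive (Eq.sym (⋀-[] Γ wk _)))
      (≤-trans p (∨-mono (reflexive (Eq.sym s)) (reflexive (⋁-[] Δ wk _))))))
    (∀ᶠ-suc⁻ (soundness d)) (⟦⟧-stable ζ))
  -- An existential is interpreted as a negated universal of a negation, so its rules are those for
  -- the universal applied to `¬′ ζ`.
  soundness (L∃ {ζ = ζ} {Γ} {Δ} d) = ∀ᶠ-suc⁺ (∀ᶠ-zip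
    (λ p s → L¬ᴮ (R∀ᴮ (≤-trans (reflexive (Eq.sym (⋀-[] Γ wk _)))
      (≤-trans (R¬ᴮ p) (∨-mono (reflexive (Eq.sym s)) (reflexive (⋁-[] Δ wk _)))))))
    (∀ᶠ-suc⁻ (soundness d)) (⟦⟧-stable (¬′ ζ)))
  soundness (R∃ {ζ = ζ} t d) = ∀ᶠ-suc⁺ (∀ᶠ-zip
    (λ p s → R¬ᴮ (≤-trans (∧-mono (instance-≤ (¬′ ζ) t s) ≤-refl) (L¬ᴮ p)))
    (∀ᶠ-suc⁻ (soundness d)) (⟦⟧-stable (¬′ ζ)))

  open Lindenbaum 𝒯 hiding (LT)

  -- Completeness and the comparison of the two orders.

  ∀-elim : ∀ {X} {φ : Formula 𝔽 ℙ (suc X)} → 𝒯 ∣ [] ⟹ ∀′ φ ∷ [] → 𝒯 ∣ [] ⟹ φ ∷ []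
  ∀-elim {φ = φ} d = cut (∀′ φ [ wk ]) (exchangeR (swap _ _ ↭-refl) (weakenR (enlarge d)))
    (L∀ (var zero) (subst (λ ψ → 𝒯 ∣ ψ ∷ [] ⟹ φ ∷ []) (sym instance-wk) identity))
    where
    instance-wk : φ [ lift wk ] [ var zero ∷ idˢ ] ≡ φ
    instance-wk = trans ([]-∘ φ (lift wk) (var zero ∷ idˢ))
      (trans (cong (φ [_]) (trans (lift-∷ wk (var zero) idˢ) (cong (var zero ∷_) ([]ˢ-id wk))))
             ([]-id φ))

  valid-∀ : ∀ {X} (φ : Formula 𝔽 ℙ (suc X)) → Valid φ → Valid (∀′ φ)
  valid-∀ φ v = ∀ᶠ-suc⁺ (∀ᶠ-map
    (λ p → All-from 1 (≤-trans (maximum _) (≤-trans (reflexive (Eq.sym I.⊤-homo)) (i-mono p)))) v)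

  completeness : ∀ X {φ : Formula 𝔽 ℙ X} → Valid φ → 𝒯 ∣ [] ⟹ φ ∷ []
  completeness zero        v = axiom v
  completeness (suc X) {φ} v = ∀-elim (completeness X (valid-∀ φ v))

  ≤ᵀ⇒≤ : ∀ {X} {φ ψ : Formula 𝔽 ℙ X} → φ ≤ᵀ ψ → ∀ᶠ λ n → ⟦ φ ⟧ n ≤ ⟦ ψ ⟧ n
  ≤ᵀ⇒≤ d = ∀ᶠ-map
    (λ p → ≤-trans (∧-greatest ≤-refl (maximum _)) (≤-trans p (∨-least ≤-refl (minimum _))))
    (soundness d)

  -- `completeness` concerns single formulas, so it is applied to the implication; a cut then
  -- recovers the sequent.
  ≤⇒≤ᵀ : ∀ {X} {φ ψ : Formula 𝔽 ℙ X} → (∀ᶠ λ n → ⟦ φ ⟧ n ≤ ⟦ ψ ⟧ n) → φ ≤ᵀ ψ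
  ≤⇒≤ᵀ {X} {φ} {ψ} e = cut (φ ⇒′ ψ)
    (exchangeR (swap _ _ ↭-refl) (weakenR (weakenL
      (completeness X (∀ᶠ-map (λ p → transpose-⇨ (≤-trans (x∧y≤y _ _) p)) e)))))
    (L⇒ (exchangeR (swap _ _ ↭-refl) (weakenR identity)) (exchangeL (swap _ _ ↭-refl) (weakenL identity)))

  -- φ and α present the same element of the colimit of the 𝐏 n.
  record Denotes n {X} (φ : Formula 𝔽 ℙ X) (α : Elt n X) : Set ℓ where
    field
      thread : Section X
      start  : thread n ≈ α
      stable : Stable n thread
      agrees : ∀ᶠ λ N → ⟦ φ ⟧ N ≈ thread N

  -- Denotation, the order and the logical operations.

  open Denotes

  -- Inequalities go up because `i` is monotone and come down because it is injective.
  thread-≤ : ∀ {X} {s t : Section X} {n} → Stable n s → Stable n t → ∀ {N} → n ≤′ N →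
             s n ≤ t n ⇔ s N ≤ t N
  thread-≤ S T ≤′-refl     = mk⇔ (λ p → p) (λ p → p)
  thread-≤ S T (≤′-step l) = mk⇔
    (λ p → ≤-trans (reflexive (Eq.sym (S _ (ℕ.≤′⇒≤ l))))
      (≤-trans (i-mono (Equivalence.to (thread-≤ S T l) p)) (reflexive (T _ (ℕ.≤′⇒≤ l)))))
    (λ p → Equivalence.from (thread-≤ S T l) (i-reflects-≤
      (≤-trans (reflexive (S _ (ℕ.≤′⇒≤ l))) (≤-trans p (reflexive (Eq.sym (T _ (ℕ.≤′⇒≤ l))))))))

  module _ {n X} {φ ψ : Formula 𝔽 ℙ X} {α β : Elt n X} (D : Denotes n φ α) (E : Denotes n ψ β) where

    denotes-mono : α ≤ β → φ ≤ᵀ ψ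
    denotes-mono p = ≤⇒≤ᵀ (∀ᶠ-zip
      (λ q r → ≤-trans (reflexive q) r) (agrees D)
      (∀ᶠ-zip (λ q r → ≤-trans q (reflexive (Eq.sym r)))
        (n , λ N n≤N → Equivalence.to (thread-≤ (stable D) (stable E) (ℕ.≤⇒≤′ n≤N))
          (≤-trans (reflexive (start D)) (≤-trans p (reflexive (Eq.sym (start E))))))
        (agrees E)))

    -- Soundness gives the inequality of threads beyond some bound. It is read off at the maximum of
    -- that bound and `n`, then brought down to `n`.
    denotes-reflects : φ ≤ᵀ ψ → α ≤ β
    denotes-reflects p = ≤-trans (reflexive (Eq.sym (start D))) (≤-trans
      (Equivalence.from (thread-≤ (stable D) (stable E) (ℕ.≤⇒≤′ (ℕ.m≤m⊔n n (proj₁ eventually))))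
        (proj₂ eventually _ (ℕ.m≤n⊔m n _)))
      (reflexive (start E)))
      where
      eventually : ∀ᶠ λ N → thread D N ≤ thread E N
      eventually = ∀ᶠ-zip (λ q r → ≤-trans (reflexive (Eq.sym q)) r) (agrees D)
        (∀ᶠ-zip (λ q r → ≤-trans q (reflexive r)) (≤ᵀ⇒≤ p) (agrees E))

  module _ {n X} {φ ψ : Formula 𝔽 ℙ X} {α β : Elt n X} (D : Denotes n φ α) (E : Denotes n ψ β) where

    denotes-cong : α ≈ β → φ ≈ᵀ ψ
    denotes-cong p = denotes-mono D E (reflexive p) , denotes-mono E D (reflexive (Eq.sym p))

    denotes-injective : φ ≈ᵀ ψ → α ≈ β
    denotes-injective (p , q) = antisym (denotes-reflects D E p) (denotes-reflects E D q)

    denotes-∧ : Denotes n (φ ∧′ ψ) (α ∧ β)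
    denotes-∧ = record
      { thread = λ N → thread D N ∧ thread E N
      ; start  = ∧-cong (start D) (start E)
      ; stable = λ N l → i-∧ (stable D N l) (stable E N l)
      ; agrees = ∀ᶠ-zip ∧-cong (agrees D) (agrees E)
      }

    denotes-∨ : Denotes n (φ ∨′ ψ) (α ∨ β)
    denotes-∨ = record
      { thread = λ N → thread D N ∨ thread E N
      ; start  = ∨-cong (start D) (start E)
      ; stable = λ N l → i-∨ (stable D N l) (stable E N l)
      ; agrees = ∀ᶠ-zip ∨-cong (agrees D) (agrees E)
      }

    denotes-⇒ : Denotes n (φ ⇒′ ψ) (¬ α ∨ β)
    denotes-⇒ = record
      { thread = λ N → ¬ thread D N ∨ thread E N
      ; start  = ∨-cong (¬-cong (start D)) (start E)
      ; stable = λ N l → i-∨ (i-¬ (stable D N l)) (stable E N l)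
      ; agrees = ∀ᶠ-zip (λ p q → ∨-cong (¬-cong p) q) (agrees D) (agrees E)
      }

  module _ {n X} {φ : Formula 𝔽 ℙ X} {α : Elt n X} (D : Denotes n φ α) where

    denotes-¬ : Denotes n (¬′ φ) (¬ α)
    denotes-¬ = record
      { thread = λ N → ¬ thread D N
      ; start  = ¬-cong (start D)
      ; stable = λ N l → i-¬ (stable D N l)
      ; agrees = ∀ᶠ-map ¬-cong (agrees D)
      }

    denotes-i : Denotes (suc n) φ (i α)
    denotes-i = record
      { thread = thread D
      ; start  = Eq.trans (Eq.sym (stable D n ℕ.≤-refl)) (I.⟦⟧-cong (start D))
      ; stable = λ N l → stable D N (ℕ.<⇒≤ l)
      ; agrees = agrees D
      }

    denotes-[] : ∀ {Y} (σ : Vec (Term 𝔽 Y) X) → Denotes n (φ [ σ ]) (σ * α)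
    denotes-[] σ = record
      { thread = λ N → σ * thread D N
      ; start  = R.⟦⟧-cong σ (start D)
      ; stable = λ N l → Eq.trans (i-* σ _) (R.⟦⟧-cong σ (stable D N l))
      ; agrees = ∀ᶠ-map (λ p → Eq.trans (⟦⟧-[] φ σ _) (R.⟦⟧-cong σ p)) (agrees D)
      }

    denotes-resp-≈ : ∀ {β} → α ≈ β → Denotes n φ β
    denotes-resp-≈ p = record
      { thread = thread D
      ; start  = Eq.trans (start D) p
      ; stable = stable D
      ; agrees = agrees D
      }

    -- The thread is kept: provably equivalent formulas have equal values only at large levels,
    -- which is all that `agrees` asks.
    denotes-resp-≈ᵀ : ∀ {ψ} → ψ ≈ᵀ φ → Denotes n ψ α
    denotes-resp-≈ᵀ (p , q) = record
      { thread = thread D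
      ; start  = start D
      ; stable = stable D
      ; agrees = ∀ᶠ-zip Eq.trans (∀ᶠ-zip antisym (≤ᵀ⇒≤ p) (≤ᵀ⇒≤ q)) (agrees D)
      }

  denotes-⊤ : ∀ {n X} → Denotes n {X} ⊤′ ⊤
  denotes-⊤ = record
    { thread = λ _ → ⊤
    ; start  = Eq.refl
    ; stable = λ _ _ → I.⊤-homo
    ; agrees = always λ _ → Eq.refl
    }

  denotes-⊥ : ∀ {n X} → Denotes n {X} ⊥′ ⊥
  denotes-⊥ = record
    { thread = λ _ → ⊥
    ; start  = Eq.refl
    ; stable = λ _ _ → I.⊥-homo
    ; agrees = always λ _ → Eq.refl
    }

  denotes-atom : ∀ {k X} (a : Elt 0 k) (ts : Vec (Term 𝔽 X) k) →
                 Denotes 0 (atom (k , a) ts) (ts * a)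
  denotes-atom a ts = record
    { thread = λ N → ts * ι a N
    ; start  = Eq.refl
    ; stable = λ _ _ → i-* ts _
    ; agrees = always λ _ → Eq.refl
    }

  denotes-∀ⁿ : ∀ {n} m {X} {φ : Formula 𝔽 ℙ (m + X)} {α : Elt n (m + X)} →
               Denotes n φ α → Denotes (suc n) (∀ⁿ m φ) (All m α)
  denotes-∀ⁿ m {φ = φ} D = record
    -- The thread is shifted by one level. Its value at zero is arbitrary, since stability is
    -- required only from `suc n` on.
    { thread = λ { zero → ⊤ ; (suc N) → All m (thread D N) }
    ; start  = All-cong m (start D)
    ; stable = λ { (suc N) (s≤s l) → i-All-cong m (stable D N l) }
    ; agrees = ∀ᶠ-suc⁺ (∀ᶠ-zip (λ p q → Eq.trans p (All-cong m q)) (⟦∀ⁿ⟧ m φ) (agrees D))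
    }

  -- Totality of denotation on both sides.

  quote-formula : ∀ n X (α : Elt n X) → ∃[ φ ] InLT n X φ × Denotes n φ α
  quote-formula zero    X α =
    -- At level zero `α` is itself a predicate symbol, applied here to the tuple of all variables.
    atom (X , α) idˢ , (_ , atom (X , α) idˢ , identity , identity) ,
    denotes-resp-≈ (denotes-atom α idˢ) (*-id α)
  quote-formula (suc n) X α = from-generated (Step.generated n X α)
    where
    from-generated : ∀ {β} → Generated (Fibre (suc n) X) _ β →
                     ∃[ φ ] InLT (suc n) X φ × Denotes (suc n) φ β
    from-generated (gen (m , β , e)) with quote-formula n (m + X) β
    ... | φ , a , D = ∀ⁿ m φ , gen (m , φ , a , identity , identity) ,
                      denotes-resp-≈ (denotes-∀ⁿ m D) (Eq.sym e)
    from-generated (gen∧ g h) with from-generated g | from-generated h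
    ... | φ , a , D | ψ , b , E = φ ∧′ ψ , gen∧ a b , denotes-∧ D E
    from-generated (gen∨ g h) with from-generated g | from-generated h
    ... | φ , a , D | ψ , b , E = φ ∨′ ψ , gen∨ a b , denotes-∨ D E
    from-generated (gen¬ g) with from-generated g
    ... | φ , a , D = ¬′ φ , gen¬ a , denotes-¬ D
    from-generated gen⊤ = ⊤′ , gen⊤ , denotes-⊤
    from-generated gen⊥ = ⊥′ , gen⊥ , denotes-⊥
    from-generated (gen≈ e g) with from-generated g
    ... | φ , a , D = φ , a , denotes-resp-≈ D e

  denotation-QF : ∀ {X} {φ : Formula 𝔽 ℙ X} → QuantifierFree φ → ∃ (Denotes 0 φ)
  denotation-QF (atom (k , a) ts) = _ , denotes-atom a ts
  denotation-QF ⊤′       = _ , denotes-⊤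
  denotation-QF ⊥′       = _ , denotes-⊥
  denotation-QF (q ∧′ r) = _ , denotes-∧ (proj₂ (denotation-QF q)) (proj₂ (denotation-QF r))
  denotation-QF (q ∨′ r) = _ , denotes-∨ (proj₂ (denotation-QF q)) (proj₂ (denotation-QF r))
  denotation-QF (¬′ q)   = _ , denotes-¬ (proj₂ (denotation-QF q))
  denotation-QF (q ⇒′ r) = _ , denotes-⇒ (proj₂ (denotation-QF q)) (proj₂ (denotation-QF r))

  -- The recursion follows the derivation of membership rather than `φ`, which is only provably
  -- equivalent to a formula of the required shape.
  denotation : ∀ n {X} {φ : Formula 𝔽 ℙ X} → InLT n X φ → ∃ (Denotes n φ)
  denotation zero    (ψ , q , e)           = _ , denotes-resp-≈ᵀ (proj₂ (denotation-QF q)) e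
  denotation (suc n) (gen (m , α , a , e)) =
    _ , denotes-resp-≈ᵀ (denotes-∀ⁿ m (proj₂ (denotation n a))) e
  denotation (suc n) (gen∧ a b) =
    _ , denotes-∧ (proj₂ (denotation (suc n) a)) (proj₂ (denotation (suc n) b))
  denotation (suc n) (gen∨ a b) =
    _ , denotes-∨ (proj₂ (denotation (suc n) a)) (proj₂ (denotation (suc n) b))
  denotation (suc n) (gen¬ a) = _ , denotes-¬ (proj₂ (denotation (suc n) a))
  denotation (suc n) gen⊤ = _ , denotes-⊤
  denotation (suc n) gen⊥ = _ , denotes-⊥
  denotation (suc n) (gen≈ (p , q) a) =
    _ , denotes-resp-≈ᵀ (proj₂ (denotation (suc n) a)) (q , p)

  private module LT = QAStratified (LT 𝒯)

  -- The isomorphism of stratified doctrines.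

  idF : Functor (Ctx 𝔽) (Ctx 𝔽)
  idF = record
    { F₀           = λ X → X
    ; F₁           = λ σ → σ
    ; F-resp-≈     = λ p → p
    ; identity     = refl
    ; homomorphism = λ _ _ → refl
    }

  idF-preserves : PreservesFiniteProducts (Ctx-products 𝔽) (Ctx-products 𝔽) idF
  idF-preserves = record
    { preserves-𝟙 = FiniteProducts.isTerminal (Ctx-products 𝔽)
    ; preserves-⊗ = λ _ _ → FiniteProducts.isProduct (Ctx-products 𝔽)
    }

  -- Pairing the two projections of a product gives its identity. This removes the reindexing along
  -- the comparison in `m-All`.
  comparison-id : ∀ X Y → PreservesFiniteProducts.comparison idF-preserves X Y ≡ idˢ
  comparison-id X Y = tabulate-++ {𝔽 = 𝔽} Y var

  module _ {n X} (α : Elt n X) where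
    formula : ∃ (InLT n X)
    formula = proj₁ (quote-formula n X α) , proj₁ (proj₂ (quote-formula n X α))

    formula-denotes : Denotes n (proj₁ formula) α
    formula-denotes = proj₂ (proj₂ (quote-formula n X α))

  module _ {n X} (φ : ∃ (InLT n X)) where
    value : Elt n X
    value = proj₁ (denotation n (proj₂ φ))

    denotes-value : Denotes n (proj₁ φ) value
    denotes-value = proj₂ (denotation n (proj₂ φ))

  to : Morphism P (LT 𝒯)
  to = record
    { M         = idF
    ; preserves = idF-preserves
    ; 𝔪         = λ n → record
      { η       = λ X → record
        { ⟦_⟧     = formula
        ; ⟦⟧-cong = denotes-cong (formula-denotes _) (formula-denotes _)
        ; ∧-homo  = λ α β → quoted (denotes-∧ (formula-denotes α) (formula-denotes β))
        ; ∨-homo  = λ α β → quoted (denotes-∨ (formula-denotes α) (formula-denotes β))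
        ; ¬-homo  = λ α → quoted (denotes-¬ (formula-denotes α))
        ; ⊤-homo  = quoted (denotes-⊤ {n})
        ; ⊥-homo  = quoted (denotes-⊥ {n})
        }
      ; commute = λ σ α → quoted (denotes-[] (formula-denotes α) σ)
      }
    ; m-i       = λ n X α → quoted (denotes-i (formula-denotes α))
    ; m-All     = λ n X Y β → quoted (denotes-∀ⁿ Y (denotes-resp-≈
        (denotes-[] (formula-denotes β) _) (Eq.trans (*-≡ (comparison-id X Y) β) (*-id β))))
    }
    where
    -- Formulas denoting the same element are provably equivalent, so each law of `to` follows by
    -- exhibiting a denotation of its other side.
    quoted : ∀ {n X} {φ : Formula 𝔽 ℙ X} {α : Elt n X} → Denotes n φ α → proj₁ (formula α) ≈ᵀ φ
    quoted D = denotes-cong (formula-denotes _) D Eq.refl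

  from : Morphism (LT 𝒯) P
  from = record
    { M         = idF
    ; preserves = idF-preserves
    ; 𝔪         = λ n → record
      { η       = λ X → record
        { ⟦_⟧     = value
        ; ⟦⟧-cong = λ {φ} {ψ} → denotes-injective (denotes-value φ) (denotes-value ψ)
        ; ∧-homo  = λ φ ψ → valued _ (denotes-∧ (denotes-value φ) (denotes-value ψ))
        ; ∨-homo  = λ φ ψ → valued _ (denotes-∨ (denotes-value φ) (denotes-value ψ))
        ; ¬-homo  = λ φ → valued _ (denotes-¬ (denotes-value φ))
        ; ⊤-homo  = valued _ denotes-⊤
        ; ⊥-homo  = valued _ denotes-⊥
        }
      ; commute = λ σ φ → valued _ (denotes-[] (denotes-value φ) σ)
      }
    ; m-i       = λ n X φ → valued (LT.Step.i n X φ) (denotes-i (denotes-value φ))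
    ; m-All     = λ n X Y φ → valued (LT.Step.All n X Y φ) (denotes-∀ⁿ Y (denotes-resp-≈ (denotes-value φ)
        (Eq.sym (Eq.trans (*-≡ (comparison-id X Y) _) (*-id _)))))
    }
    where
    -- Dually, a formula denotes at most one element up to equality, which yields every law of
    -- `from`.
    valued : ∀ {n X} (φ : ∃ (InLT n X)) {α : Elt n X} → Denotes n (proj₁ φ) α → value φ ≈ α
    valued φ D = denotes-injective (denotes-value φ) D (identity , identity)

  isomorphism : Isomorphism P (LT 𝒯)
  isomorphism = record
    { to      = to
    ; from    = from
    ; from∘to = record
      { on-objects = λ _ → refl
      ; on-arrows  = λ _ → refl
      ; on-fibres  = λ n X α → denotes-injective
          (denotes-value (formula α)) (formula-denotes α) (identity , identity)
      }
    ; to∘from = record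
      { on-objects = λ _ → refl
      ; on-arrows  = λ _ → refl
      ; on-fibres  = λ n X φ → denotes-cong
          (formula-denotes (value φ)) (denotes-value φ) Eq.refl
      }
    }

theorem3p18 : ∀ {ℓ : Level} (𝔽 : Signature ℓ) (P : QAStratified (Ctx-products 𝔽) ℓ) →
    Σ[ ℙ ∈ Signature ℓ ] Σ[ 𝒯 ∈ Theory 𝔽 ℙ ] Isomorphism P (LT 𝒯)
theorem3p18 𝔽 P = InternalLogic.ℙ P , InternalLogic.𝒯 P , InternalLogic.isomorphism P
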